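{- Let $d\ge 2$. For $B\ge 1$ let $P_1(d,B)$ be the set of monic polynomials of degree $d$ with integer coefficients, all bounded in absolute value by $B$, and with constant coefficient $1$; let $R_1(d,B)\subseteq P_1(d,B)$ be the subset of those polynomials that are reducible over $\mathbb{Z}$. Then the coefficient vectors $(a_1,\dots,a_{d-1})$ of the polynomials in $R_1(d,B)$ (for all $B$) lie on an algebraic hypersurface of $\mathbb{C}^{d-1}$, and consequently \[\frac{|R_1(d,B)|}{|P_1(d,B)|}=O\!\left(\frac1B\right)\quad (B\to\infty).\] -}

module Defs where

open import Algebra.Bundles.Raw using (RawSemiring)
open import Data.Bool.Base using (if_then_else_)
open import Data.Fin.Base using (Fin; toℕ)
import Data.Fin.Properties as Fin
open import Data.Integer.Base as ℤ using (ℤ; 0ℤ; 1ℤ)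
open import Data.List.Base using (List; []; _∷_; map; foldr)
open import Data.Nat.Base as ℕ using (ℕ; zero; suc)
import Data.Nat.Properties as ℕ
open import Data.Product.Base using (_×_; _,_; ∃; ∃₂; ∃-syntax; Σ-syntax; proj₁; proj₂)
open import Data.Rational.Base as ℚ using (ℚ; 0ℚ; 1ℚ; ½)
import Data.Rational.Properties as ℚ
open import Data.Rational.Solver using (module +-*-Solver)
open import Data.Vec.Base as Vec using (Vec)
open import Data.Vec.Functional using (Vector)
open import Data.Vec.Properties using (≡-dec)
open import Function.Bundles using (Bijection)
open import Level using (0ℓ)
open import Relation.Binary.Bundles using (Setoid)
import Relation.Binary.Construct.On as On
open import Relation.Binary.PropositionalEquality
  using (_≡_; _≢_; refl; sym; trans; cong; cong₂; subst)
open import Relation.Nullary using (¬_; does)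
import Algebra.Definitions.RawSemiring as RawSemiringDefinitions

------------------------------------------------------------------------
-- The ring ℤ[x].  A polynomial is the list of its coefficients, constant
-- coefficient first; trailing zeros are allowed, so equality is equality
-- of all coefficients.

ℤ[x] : Set
ℤ[x] = List ℤ

coeff : ℤ[x] → ℕ → ℤ
coeff []      _       = 0ℤ
coeff (a ∷ f) zero    = a
coeff (a ∷ f) (suc n) = coeff f n

infixl 6 _+ₚ_
infixl 7 _*ₚ_
infix  4 _≈ₚ_

-- A record, so that f and g can be inferred from a proof of f ≈ₚ g.
record _≈ₚ_ (f g : ℤ[x]) : Set where
  constructor mk≈ₚ
  field coeff-≡ : ∀ n → coeff f n ≡ coeff g n
open _≈ₚ_ public

_+ₚ_ : ℤ[x] → ℤ[x] → ℤ[x]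
[]      +ₚ g       = g
(a ∷ f) +ₚ []      = a ∷ f
(a ∷ f) +ₚ (b ∷ g) = (a ℤ.+ b) ∷ (f +ₚ g)

_*ₚ_ : ℤ[x] → ℤ[x] → ℤ[x]
[]      *ₚ g = []
(a ∷ f) *ₚ g = map (a ℤ.*_) g +ₚ (0ℤ ∷ (f *ₚ g))

ℤ[x]-setoid : Setoid 0ℓ 0ℓ
ℤ[x]-setoid = record
  { Carrier       = ℤ[x]
  ; _≈_           = _≈ₚ_
  ; isEquivalence = record
    { refl  = mk≈ₚ λ _ → refl
    ; sym   = λ p → mk≈ₚ λ n → sym (coeff-≡ p n)
    ; trans = λ p q → mk≈ₚ λ n → trans (coeff-≡ p n) (coeff-≡ q n)
    }
  }

ℤ[x]-rawSemiring : RawSemiring 0ℓ 0ℓ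
ℤ[x]-rawSemiring = record
  { Carrier = ℤ[x]
  ; _≈_     = _≈ₚ_
  ; _+_     = _+ₚ_
  ; _*_     = _*ₚ_
  ; 0#      = []
  ; 1#      = 1ℤ ∷ []
  }

Unit : ℤ[x] → Set
Unit f = f ∣ 1#
  where
  open RawSemiring ℤ[x]-rawSemiring using (1#)
  open RawSemiringDefinitions ℤ[x]-rawSemiring using (_∣_)

-- Used below for monic polynomials only, so that the case f = 0 is of no
-- concern; a product of non-units is itself a non-unit.
Reducible : ℤ[x] → Set
Reducible f = ∃₂ λ g h → f ≈ₚ g *ₚ h × ¬ Unit g × ¬ Unit h

------------------------------------------------------------------------

record P₁ (d B : ℕ) (f : ℤ[x]) : Set where
  field
    degree≤d : ∀ n → n ℕ.> d → coeff f n ≡ 0ℤ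
    monic    : coeff f d ≡ 1ℤ
    constant : coeff f 0 ≡ 1ℤ
    bounded  : ∀ n → ℤ.∣ coeff f n ∣ ℕ.≤ B

R₁ : (d B : ℕ) → ℤ[x] → Set
R₁ d B f = P₁ d B f × Reducible f

infix 4 _HasCardinality_

-- Polynomials are counted up to _≈ₚ_.
_HasCardinality_ : (ℤ[x] → Set) → ℕ → Set
P HasCardinality n =
  Bijection (Fin.≡-setoid n) (On.setoid {B = ∃ P} ℤ[x]-setoid proj₁)

------------------------------------------------------------------------

IsCauchy : (ℕ → ℚ) → Set
IsCauchy x = ∀ ε → ε ℚ.> 0ℚ →
  ∃[ N ] (∀ m n → m ℕ.≥ N → n ℕ.≥ N → ℚ.∣ x m ℚ.- x n ∣ ℚ.< ε)

record ℝ : Set where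
  constructor mkℝ
  field
    seq    : ℕ → ℚ
    cauchy : IsCauchy seq
open ℝ public

infix 4 _≈ᵣ_

_≈ᵣ_ : ℝ → ℝ → Set
x ≈ᵣ y = ∀ ε → ε ℚ.> 0ℚ →
  ∃[ N ] (∀ n → n ℕ.≥ N → ℚ.∣ seq x n ℚ.- seq y n ∣ ℚ.< ε)

private
  halves : ∀ ε → ½ ℚ.* ε ℚ.+ ½ ℚ.* ε ≡ ε
  halves ε = trans (sym (ℚ.*-distribʳ-+ ε ½ ½)) (ℚ.*-identityˡ ε)

  half-pos : ∀ {ε} → ε ℚ.> 0ℚ → ½ ℚ.* ε ℚ.> 0ℚ
  half-pos {ε} ε>0 =
    subst (ℚ._< ½ ℚ.* ε) (ℚ.*-zeroʳ ½) (ℚ.*-monoʳ-<-pos ½ ε>0)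

  ∣+∣< : ∀ {ε} p q → ℚ.∣ p ∣ ℚ.< ½ ℚ.* ε → ℚ.∣ q ∣ ℚ.< ½ ℚ.* ε →
         ℚ.∣ p ℚ.+ q ∣ ℚ.< ε
  ∣+∣< {ε} p q p< q< = subst (ℚ.∣ p ℚ.+ q ∣ ℚ.<_) (halves ε)
    (ℚ.≤-<-trans (ℚ.∣p+q∣≤∣p∣+∣q∣ p q) (ℚ.+-mono-< p< q<))

  -- If 0 < K then ε / K is a positive number δ with K δ = ε.
  quotient : ∀ {K ε} → K ℚ.> 0ℚ → ε ℚ.> 0ℚ →
             Σ[ δ ∈ ℚ ] δ ℚ.> 0ℚ × K ℚ.* δ ≡ ε
  quotient {K} {ε} K>0 ε>0 = 1/K ℚ.* ε , δ>0 ,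
    trans (sym (ℚ.*-assoc K 1/K ε))
      (trans (cong (ℚ._* ε) (ℚ.*-inverseʳ K)) (ℚ.*-identityˡ ε))
    where
    instance
      posK : ℚ.Positive K
      posK = ℚ.positive K>0
      nzK : ℚ.NonZero K
      nzK = ℚ.pos⇒nonZero K
    1/K : ℚ
    1/K = ℚ.1/ K
    instance
      pos1/K : ℚ.Positive 1/K
      pos1/K = ℚ.1/pos⇒pos K
    δ>0 : 1/K ℚ.* ε ℚ.> 0ℚ
    δ>0 = subst (ℚ._< 1/K ℚ.* ε) (ℚ.*-zeroʳ 1/K) (ℚ.*-monoʳ-<-pos 1/K ε>0)

  ∣*∣< : ∀ {K δ} p q → K ℚ.> 0ℚ → ℚ.∣ p ∣ ℚ.≤ K → ℚ.∣ q ∣ ℚ.< δ →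
         ℚ.∣ p ℚ.* q ∣ ℚ.< K ℚ.* δ
  ∣*∣< {K} {δ} p q K>0 p≤ q< = begin-strict
    ℚ.∣ p ℚ.* q ∣         ≡⟨ ℚ.∣p*q∣≡∣p∣*∣q∣ p q ⟩
    ℚ.∣ p ∣ ℚ.* ℚ.∣ q ∣   ≤⟨ ℚ.*-monoʳ-≤-nonNeg ℚ.∣ q ∣ p≤ ⟩
    K ℚ.* ℚ.∣ q ∣         <⟨ ℚ.*-monoʳ-<-pos K q< ⟩
    K ℚ.* δ               ∎
    where
    open ℚ.≤-Reasoning
    instance
      posK : ℚ.Positive K
      posK = ℚ.positive K>0
      nn : ℚ.NonNegative ℚ.∣ q ∣
      nn = ℚ.∣-∣-nonNeg q

  0<1 : 0ℚ ℚ.< 1ℚ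
  0<1 = ℚ.positive⁻¹ 1ℚ

  eventually-bounded : ∀ {x} → IsCauchy x →
    ∃[ K ] (K ℚ.> 0ℚ × ∃[ N ] (∀ n → n ℕ.≥ N → ℚ.∣ x n ∣ ℚ.≤ K))
  eventually-bounded {x} cx with cx 1ℚ 0<1
  ... | N , close = 1ℚ ℚ.+ ℚ.∣ x N ∣
      , ℚ.+-mono-<-≤ 0<1 (ℚ.0≤∣p∣ (x N))
      , N , λ n n≥N → begin
        ℚ.∣ x n ∣                          ≡⟨ cong ℚ.∣_∣ (split (x n) (x N)) ⟩
        ℚ.∣ (x n ℚ.- x N) ℚ.+ x N ∣        ≤⟨ ℚ.∣p+q∣≤∣p∣+∣q∣ (x n ℚ.- x N) (x N) ⟩
        ℚ.∣ x n ℚ.- x N ∣ ℚ.+ ℚ.∣ x N ∣    ≤⟨ ℚ.+-monoˡ-≤ ℚ.∣ x N ∣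
                                                (ℚ.<⇒≤ (close n N n≥N ℕ.≤-refl)) ⟩
        1ℚ ℚ.+ ℚ.∣ x N ∣                   ∎
    where
    open ℚ.≤-Reasoning
    split : ∀ a b → a ≡ (a ℚ.- b) ℚ.+ b
    split = solve 2 (λ a b → a := (a :- b) :+ b) refl
      where open +-*-Solver

  ∣+-+∣< : ∀ {ε} a b a′ b′ →
           ℚ.∣ a ℚ.- a′ ∣ ℚ.< ½ ℚ.* ε → ℚ.∣ b ℚ.- b′ ∣ ℚ.< ½ ℚ.* ε →
           ℚ.∣ (a ℚ.+ b) ℚ.- (a′ ℚ.+ b′) ∣ ℚ.< ε
  ∣+-+∣< {ε} a b a′ b′ p q =
    subst (λ z → ℚ.∣ z ∣ ℚ.< ε) (sym (rearrange a b a′ b′))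
      (∣+∣< (a ℚ.- a′) (b ℚ.- b′) p q)
    where
    open +-*-Solver
    rearrange : ∀ a b a′ b′ →
      (a ℚ.+ b) ℚ.- (a′ ℚ.+ b′) ≡ (a ℚ.- a′) ℚ.+ (b ℚ.- b′)
    rearrange = solve 4 (λ a b a′ b′ →
      (a :+ b) :- (a′ :+ b′) := (a :- a′) :+ (b :- b′)) refl

  ∣*-*∣< : ∀ {ε K L δ η} a b a′ b′ → K ℚ.> 0ℚ → L ℚ.> 0ℚ →
           K ℚ.* δ ≡ ½ ℚ.* ε → L ℚ.* η ≡ ½ ℚ.* ε →
           ℚ.∣ a ∣ ℚ.≤ K → ℚ.∣ b′ ∣ ℚ.≤ L →
           ℚ.∣ a ℚ.- a′ ∣ ℚ.< η → ℚ.∣ b ℚ.- b′ ∣ ℚ.< δ →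
           ℚ.∣ a ℚ.* b ℚ.- a′ ℚ.* b′ ∣ ℚ.< ε
  ∣*-*∣< {ε} a b a′ b′ K>0 L>0 Kδ Lη a≤K b′≤L p q =
    subst (λ z → ℚ.∣ z ∣ ℚ.< ε) (sym (rearrange a b a′ b′))
      (∣+∣< (a ℚ.* (b ℚ.- b′)) (b′ ℚ.* (a ℚ.- a′))
        (subst (ℚ.∣ a ℚ.* (b ℚ.- b′) ∣ ℚ.<_) Kδ (∣*∣< a (b ℚ.- b′) K>0 a≤K q))
        (subst (ℚ.∣ b′ ℚ.* (a ℚ.- a′) ∣ ℚ.<_) Lη (∣*∣< b′ (a ℚ.- a′) L>0 b′≤L p)))
    where
    open +-*-Solver
    rearrange : ∀ a b a′ b′ →
      a ℚ.* b ℚ.- a′ ℚ.* b′ ≡ a ℚ.* (b ℚ.- b′) ℚ.+ b′ ℚ.* (a ℚ.- a′)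
    rearrange = solve 4 (λ a b a′ b′ →
      a :* b :- a′ :* b′ := a :* (b :- b′) :+ b′ :* (a :- a′)) refl

-- Opaque, since unfolding these proofs makes type checking very slow; only
-- the sequences matter.
abstract
  const-cauchy : ∀ q → IsCauchy (λ _ → q)
  const-cauchy q ε ε>0 = 0 , λ _ _ _ _ →
    subst (ℚ._< ε) (cong ℚ.∣_∣ (sym (ℚ.+-inverseʳ q))) ε>0

  +-cauchy : ∀ {x y} → IsCauchy x → IsCauchy y → IsCauchy (λ n → x n ℚ.+ y n)
  +-cauchy {x} {y} cx cy ε ε>0
    with cx (½ ℚ.* ε) (half-pos ε>0) | cy (½ ℚ.* ε) (half-pos ε>0)
  ... | M , p | N , q = M ℕ.⊔ N , λ m n m≥ n≥ →
    ∣+-+∣< (x m) (y m) (x n) (y n)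
      (p m n (ℕ.m⊔n≤o⇒m≤o M N m≥) (ℕ.m⊔n≤o⇒m≤o M N n≥))
      (q m n (ℕ.m⊔n≤o⇒n≤o M N m≥) (ℕ.m⊔n≤o⇒n≤o M N n≥))

  *-cauchy : ∀ {x y} → IsCauchy x → IsCauchy y → IsCauchy (λ n → x n ℚ.* y n)
  *-cauchy {x} {y} cx cy ε ε>0 =
    let K , K>0 , N₁ , x≤K = eventually-bounded {x} cx
        L , L>0 , N₂ , y≤L = eventually-bounded {y} cy
        δ , δ>0 , Kδ       = quotient K>0 (half-pos ε>0)
        η , η>0 , Lη       = quotient L>0 (half-pos ε>0)
        N₃ , p             = cx η η>0
        N₄ , q             = cy δ δ>0
        A = N₁ ℕ.⊔ N₂
        B = N₃ ℕ.⊔ N₄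
    in A ℕ.⊔ B , λ m n m≥ n≥ →
       ∣*-*∣< (x m) (y m) (x n) (y n) K>0 L>0 Kδ Lη
         (x≤K m (ℕ.m⊔n≤o⇒m≤o N₁ N₂ (ℕ.m⊔n≤o⇒m≤o A B m≥)))
         (y≤L n (ℕ.m⊔n≤o⇒n≤o N₁ N₂ (ℕ.m⊔n≤o⇒m≤o A B n≥)))
         (p m n (ℕ.m⊔n≤o⇒m≤o N₃ N₄ (ℕ.m⊔n≤o⇒n≤o A B m≥))
                (ℕ.m⊔n≤o⇒m≤o N₃ N₄ (ℕ.m⊔n≤o⇒n≤o A B n≥)))
         (q m n (ℕ.m⊔n≤o⇒n≤o N₃ N₄ (ℕ.m⊔n≤o⇒n≤o A B m≥))
                (ℕ.m⊔n≤o⇒n≤o N₃ N₄ (ℕ.m⊔n≤o⇒n≤o A B n≥)))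

infixl 6 _+ᵣ_ _-ᵣ_
infixl 7 _*ᵣ_

fromℚ : ℚ → ℝ
fromℚ q = mkℝ (λ _ → q) (const-cauchy q)

_+ᵣ_ : ℝ → ℝ → ℝ
x +ᵣ y = mkℝ (λ n → seq x n ℚ.+ seq y n) (+-cauchy {seq x} {seq y} (cauchy x) (cauchy y))

_*ᵣ_ : ℝ → ℝ → ℝ
x *ᵣ y = mkℝ (λ n → seq x n ℚ.* seq y n) (*-cauchy {seq x} {seq y} (cauchy x) (cauchy y))

_-ᵣ_ : ℝ → ℝ → ℝ
x -ᵣ y = x +ᵣ (fromℚ (ℚ.- 1ℚ) *ᵣ y)

------------------------------------------------------------------------

record ℂ : Set where
  constructor _+i_
  field
    re im : ℝ
open ℂ public

ℂ-rawSemiring : RawSemiring 0ℓ 0ℓ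
ℂ-rawSemiring = record
  { Carrier = ℂ
  ; _≈_     = λ z w → re z ≈ᵣ re w × im z ≈ᵣ im w
  ; _+_     = λ z w → (re z +ᵣ re w) +i (im z +ᵣ im w)
  ; _*_     = λ z w → (re z *ᵣ re w -ᵣ im z *ᵣ im w) +i
                      (re z *ᵣ im w +ᵣ im z *ᵣ re w)
  ; 0#      = fromℚ 0ℚ +i fromℚ 0ℚ
  ; 1#      = fromℚ 1ℚ +i fromℚ 0ℚ
  }

open RawSemiring ℂ-rawSemiring public
  using () renaming (_≈_ to _≈ᶜ_; _+_ to _+ᶜ_; _*_ to _*ᶜ_; 0# to 0ᶜ; 1# to 1ᶜ)

fromℤ : ℤ → ℂ
fromℤ a = fromℚ (a ℚ./ 1) +i fromℚ 0ℚ

------------------------------------------------------------------------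
-- Polynomials in n variables over ℂ, as formal sums of terms c x₁^e₁⋯xₙ^eₙ.
-- An exponent vector may occur in several terms, so the coefficient of a
-- monomial is the sum over all terms with that exponent vector.

ℂ[_] : ℕ → Set
ℂ[ n ] = List (ℂ × Vec ℕ n)

coefficientAt : ∀ {n} → Vec ℕ n → ℂ[ n ] → ℂ
coefficientAt e = foldr
  (λ (c , e′) s → if does (≡-dec ℕ._≟_ e′ e) then c +ᶜ s else s) 0ᶜ

evaluate : ∀ {n} → ℂ[ n ] → Vector ℂ n → ℂ
evaluate F z = foldr
  (λ (c , e) s → (c *ᶜ product (λ i → z i ^ Vec.lookup e i)) +ᶜ s) 0ᶜ F
  where open RawSemiringDefinitions ℂ-rawSemiring using (_^_; product)

NonConstant : ∀ {n} → ℂ[ n ] → Set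
NonConstant {n} F =
  ∃[ e ] (e ≢ Vec.replicate n 0 × ¬ coefficientAt e F ≈ᶜ 0ᶜ)

record AlgebraicHypersurface (n : ℕ) : Set where
  field
    equation    : ℂ[ n ]
    nonConstant : NonConstant equation

infix 4 _∈ʰ_

_∈ʰ_ : ∀ {n} → Vector ℂ n → AlgebraicHypersurface n → Set
z ∈ʰ H = evaluate (AlgebraicHypersurface.equation H) z ≈ᶜ 0ᶜ

-- (a₁,…,a_{d-1}), where aᵢ is the coefficient of xⁱ.
coefficientVector : (d : ℕ) → ℤ[x] → Vector ℂ (d ℕ.∸ 1)
coefficientVector d f i = fromℤ (coeff f (suc (toℕ i)))

module Submission where

-- A reducible f of degree d with leading and constant coefficient 1 is a
-- product of two polynomials with leading coefficient 1 and equal constant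
-- coefficients ε = ±1.  Only d − 2 coefficients of the factors are free, so for
-- each ε and each pair of degrees the coefficient vectors (a₁,…,a_{d-1}) are
-- parametrised by ℤ^(d-2), each aᵢ being of degree at most 2 in each parameter.
-- Counting monomials against interpolation conditions gives, by linear algebra
-- over ℤ, a nonconstant F that vanishes under all these parametrisations at
-- once; this is the hypersurface.  The Schwartz–Zippel bound for the zeros of F
-- in the box [−B,B]^(d-1) gives the ratio O(1/B).  For the cardinality of R₁ to
-- exist constructively, reducibility has to be decidable: at large integers x
-- the values of the factors are bounded by f(x) > 0, hence so are their
-- coefficients, by interpolation.

open import Defs
open import Data.Nat.Base using (ℕ; _≤_; _∸_; NonZero)
open import Data.Rational.Base as ℚ using (ℚ; _/_)
open import Data.Product.Base using (Σ-syntax; ∃-syntax; _×_)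

open import Data.Bool.Base using (if_then_else_; true; false)
open import Data.Fin.Base using (Fin; zero; suc; toℕ)
open import Data.Integer.Base as ℤ using (ℤ; 0ℤ; 1ℤ; -1ℤ; ∣_∣; _+_; _*_; _-_; -_; _^_)
import Data.Integer.Properties as ℤ
open import Data.Integer.Tactic.RingSolver using (solve-∀)
open import Data.List.Base as List
  using (List; []; _∷_; [_]; _++_; map; length; take; drop; filter; foldr; upTo;
         cartesianProduct; cartesianProductWith)
open import Data.List.Membership.Propositional using (_∈_; find; lose)
open import Data.List.Membership.Propositional.Properties
  using (∈-∃++; ∈-++⁺ˡ; ∈-++⁺ʳ; ∈-++⁻; ∈-map⁺; ∈-map⁻; ∈-upTo⁺; ∈-upTo⁻; ∈-lookup;
         ∈-cartesianProduct⁺; ∈-cartesianProduct⁻; ∈-cartesianProductWith⁺;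
         ∈-cartesianProductWith⁻; ∈-filter⁺; ∈-filter⁻)
import Data.List.Properties as List
open import Data.List.Relation.Unary.All as All using (All; []; _∷_)
import Data.List.Relation.Unary.All.Properties as All
open import Data.List.Relation.Unary.Any as Any using (Any; here; there)
import Data.List.Relation.Unary.Any.Properties as Any
open import Data.List.Relation.Unary.Unique.Propositional using (Unique; []; _∷_)
import Data.List.Relation.Unary.Unique.Propositional.Properties as Unique
open import Data.Nat.Base as ℕ using (zero; suc; _<_; z≤n; s≤s)
import Data.Nat.Properties as ℕ
import Data.Nat.Tactic.RingSolver as ℕ-Solver
open import Data.Product.Base using (_,_; ∃₂; proj₁; proj₂)
open import Data.Rational.Base using (0ℚ; 1ℚ)
import Data.Rational.Properties as ℚ
import Data.Rational.Unnormalised.Base as ℚᵘ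
import Data.Rational.Unnormalised.Properties as ℚᵘ
open import Data.Sum.Base using (_⊎_; inj₁; inj₂; [_,_]′)
open import Data.Unit.Base using (⊤; tt)
open import Data.Vec.Base as Vec using (Vec; []; _∷_; head; lookup; tabulate; toList)
import Data.Vec.Properties as Vec
open import Data.Vec.Relation.Unary.All as VecAll using ([]; _∷_)
import Data.Vec.Relation.Unary.All.Properties as VecAll
open import Function.Base using (_∘_; case_of_)
open import Relation.Binary.Definitions using (tri<; tri≈; tri>)
open import Relation.Binary.PropositionalEquality hiding ([_])
open import Relation.Nullary.Decidable using (Dec; does; yes; no; ¬?; decidable-stable; map′)
open import Relation.Nullary.Negation using (¬_; contradiction)
open import Relation.Unary using (Pred; Decidable)
import Algebra.Definitions.RawMagma as RawMagma
open import Algebra.Definitions.RawSemiring ℂ-rawSemiring using (product) renaming (_^_ to _^ᶜ_)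

-- Polynomials in one variable over ℤ

-- The counting works because there is one parameter fewer than there are coordinates. With
-- `n = d - 1` and exponents below `N`, a polynomial has `N ^ n` coefficients, while vanishing on
-- all parametrisations costs only a constant multiple of `N ^ (n - 1)` conditions, so a large `N`
-- leaves a nonzero solution. This yields one equation for all signs and degree splits without
-- resultants. A nonzero solution could still be a constant polynomial; one further condition kills
-- the constant coefficient and excludes this. Every argument takes place over ℤ, where equality is
-- decidable and there are no zero divisors. ℂ enters only at the end: `F` has integer coefficients
-- and is evaluated at integer points, so each complex number involved has constant rational
-- sequences as its real and imaginary parts. One division by `x - a` serves twice: it bounds the
-- number of roots, and it turns bounds on values into bounds on coefficients, which makes the
-- search for factors finite.

eval : ℤ[x] → ℤ → ℤ
eval []      x = 0ℤ
eval (c ∷ p) x = c + x * eval p x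

eval-+ : ∀ p q x → eval (p +ₚ q) x ≡ eval p x + eval q x
eval-+ []      q       x = sym (ℤ.+-identityˡ (eval q x))
eval-+ (a ∷ p) []      x = sym (ℤ.+-identityʳ _)
eval-+ (a ∷ p) (b ∷ q) x =
  trans (cong (λ y → a + b + x * y) (eval-+ p q x)) (regroup a b x (eval p x) (eval q x))
  where
  regroup : ∀ a b x u v → a + b + x * (u + v) ≡ a + x * u + (b + x * v)
  regroup = solve-∀

eval-scale : ∀ a p x → eval (map (a *_) p) x ≡ a * eval p x
eval-scale a []      x = sym (ℤ.*-zeroʳ a)
eval-scale a (c ∷ p) x =
  trans (cong (λ y → a * c + x * y) (eval-scale a p x)) (regroup a c x (eval p x))
  where
  regroup : ∀ a c x u → a * c + x * (a * u) ≡ a * (c + x * u)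
  regroup = solve-∀

eval-* : ∀ p q x → eval (p *ₚ q) x ≡ eval p x * eval q x
eval-* []      q x = refl
eval-* (a ∷ p) q x = begin
  eval (map (a *_) q +ₚ (0ℤ ∷ p *ₚ q)) x
    ≡⟨ eval-+ (map (a *_) q) (0ℤ ∷ p *ₚ q) x ⟩
  eval (map (a *_) q) x + (0ℤ + x * eval (p *ₚ q) x)
    ≡⟨ cong₂ (λ u v → u + (0ℤ + x * v)) (eval-scale a q x) (eval-* p q x) ⟩
  a * eval q x + (0ℤ + x * (eval p x * eval q x))
    ≡⟨ regroup a x (eval p x) (eval q x) ⟩
  (a + x * eval p x) * eval q x ∎
  where
  open ≡-Reasoning
  regroup : ∀ a x u v → a * v + (0ℤ + x * (u * v)) ≡ (a + x * u) * v
  regroup = solve-∀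

coeff≡0⇒eval≡0 : ∀ p → (∀ n → coeff p n ≡ 0ℤ) → ∀ x → eval p x ≡ 0ℤ
coeff≡0⇒eval≡0 []      p≡0 x = refl
coeff≡0⇒eval≡0 (c ∷ p) p≡0 x =
  cong₂ _+_ (p≡0 0)
    (trans (cong (x *_) (coeff≡0⇒eval≡0 p (p≡0 ∘ suc) x)) (ℤ.*-zeroʳ x))

eval-cong : ∀ p q → (∀ n → coeff p n ≡ coeff q n) → ∀ x → eval p x ≡ eval q x
eval-cong []      q       p≡q x = sym (coeff≡0⇒eval≡0 q (sym ∘ p≡q) x)
eval-cong (a ∷ p) []      p≡q x = coeff≡0⇒eval≡0 (a ∷ p) p≡q x
eval-cong (a ∷ p) (b ∷ q) p≡q x =
  cong₂ (λ u v → u + x * v) (p≡q 0) (eval-cong p q (p≡q ∘ suc) x)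

-- The quotient of c + x p(x) by x − a, for any c.
quotient : ℤ → ℤ[x] → ℤ[x]
quotient a []      = []
quotient a (c ∷ p) = eval (c ∷ p) a ∷ quotient a p

length-quotient : ∀ a p → length (quotient a p) ≡ length p
length-quotient a []      = refl
length-quotient a (c ∷ p) = cong suc (length-quotient a p)

-- Synthetic division. The constant term cancels in a difference of two values, so the induction is
-- run on `x * eval p x` and the constant is restored in `eval-difference`.
eval-quotient : ∀ a p x →
  x * eval p x ≡ a * eval p a + (x - a) * eval (quotient a p) x
eval-quotient a []      x = regroup a x
  where
  regroup : ∀ a x → x * 0ℤ ≡ a * 0ℤ + (x - a) * 0ℤ
  regroup = solve-∀
eval-quotient a (c ∷ p) x =
  trans (cong (λ y → x * (c + y)) (eval-quotient a p x))
        (regroup a x c (eval p a) (eval (quotient a p) x))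
  where
  regroup : ∀ a x c u v →
    x * (c + (a * u + (x - a) * v)) ≡ a * (c + a * u) + (x - a) * (c + a * u + x * v)
  regroup = solve-∀

eval-difference : ∀ a c p x →
  (x - a) * eval (quotient a p) x ≡ eval (c ∷ p) x - eval (c ∷ p) a
eval-difference a c p x = begin
  (x - a) * q                                   ≡⟨ regroup c (a * eval p a) _ ⟩
  (c + (a * eval p a + (x - a) * q)) - (c + a * eval p a)
    ≡⟨ cong (λ y → c + y - (c + a * eval p a)) (eval-quotient a p x) ⟨
  eval (c ∷ p) x - eval (c ∷ p) a ∎
  where
  open ≡-Reasoning
  q = eval (quotient a p) x
  regroup : ∀ c u v → v ≡ (c + (u + v)) - (c + u)
  regroup = solve-∀

constant≡0 : ∀ a c p → (∀ n → coeff p n ≡ 0ℤ) → eval (c ∷ p) a ≡ 0ℤ → c ≡ 0ℤ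
constant≡0 a c p p≡0 e = begin
  c                   ≡⟨ ℤ.+-identityʳ c ⟨
  c + 0ℤ              ≡⟨ cong (c +_) (ℤ.*-zeroʳ a) ⟨
  c + a * 0ℤ          ≡⟨ cong (λ y → c + a * y) (coeff≡0⇒eval≡0 p p≡0 a) ⟨
  c + a * eval p a    ≡⟨ e ⟩
  0ℤ                  ∎
  where open ≡-Reasoning

-- The entries of `quotient a p` are the Horner values at `a` of the suffixes of `p`; the last one
-- is the last coefficient itself, so the coefficients are recovered from the top down.
quotient≡0⇒≡0 : ∀ a p → (∀ n → coeff (quotient a p) n ≡ 0ℤ) → ∀ n → coeff p n ≡ 0ℤ
quotient≡0⇒≡0 a []      q≡0 n       = refl
quotient≡0⇒≡0 a (c ∷ p) q≡0 zero    =
  constant≡0 a c p (quotient≡0⇒≡0 a p (q≡0 ∘ suc)) (q≡0 0)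
quotient≡0⇒≡0 a (c ∷ p) q≡0 (suc n) = quotient≡0⇒≡0 a p (q≡0 ∘ suc) n

-- Division by `x - a` at the first root `a` shortens the list by one, and the quotient keeps all
-- other roots since ℤ has no zero divisors. Lengths are degrees plus one, so `length p ≤ length S`
-- means more roots than the degree.
many-roots⇒≡0 : ∀ p {S} → Unique S → All (λ x → eval p x ≡ 0ℤ) S →
                length p ≤ length S → ∀ n → coeff p n ≡ 0ℤ
many-roots⇒≡0 []      uS roots len n = refl
many-roots⇒≡0 (c ∷ p) {a ∷ S} (a∉S ∷ uS) (pa≡0 ∷ roots) (s≤s len) = λ where
    zero    → constant≡0 a c p p≡0 pa≡0
    (suc n) → p≡0 n
  where
  root : ∀ {x} → a ≢ x × eval (c ∷ p) x ≡ 0ℤ → eval (quotient a p) x ≡ 0ℤ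
  root {x} (a≢x , px≡0) with ℤ.i*j≡0⇒i≡0∨j≡0 (x - a)
         (trans (eval-difference a c p x) (cong₂ _-_ px≡0 pa≡0))
  ... | inj₁ x-a≡0 = contradiction (sym (ℤ.i-j≡0⇒i≡j x a x-a≡0)) a≢x
  ... | inj₂ q≡0   = q≡0
  p≡0 = quotient≡0⇒≡0 a p (many-roots⇒≡0 (quotient a p) uS
          (All.map root (All.zip (a∉S , roots)))
          (subst (_≤ length S) (sym (length-quotient a p)) len))

root-count : ∀ p {n} → coeff p n ≢ 0ℤ → ∀ {S} → Unique S →
             length (filter (λ x → eval p x ℤ.≟ 0ℤ) S) < length p
root-count p {n} pn≢0 {S} uS = ℕ.≰⇒> λ len → pn≢0
  (many-roots⇒≡0 p (Unique.filter⁺ root? uS) (All.all-filter root? S) len n)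
  where root? = λ x → eval p x ℤ.≟ 0ℤ

-- A bound on the coefficients of any polynomial with at most as many
-- coefficients as S has elements and with |p(x)| ≤ V for x in S.
interpolationBound : List ℤ → ℕ → ℕ
interpolationBound []      V = 0
interpolationBound (a ∷ S) V = V ℕ.+ suc ∣ a ∣ ℕ.* interpolationBound S (V ℕ.+ V)

∣j∣≤∣i*j∣ : ∀ i j → i ≢ 0ℤ → ∣ j ∣ ≤ ∣ i * j ∣
∣j∣≤∣i*j∣ i j i≢0 = subst (∣ j ∣ ≤_) (sym (ℤ.abs-* i j))
  (ℕ.m≤n*m ∣ j ∣ ∣ i ∣ {{ℕ.≢-nonZero (i≢0 ∘ ℤ.∣i∣≡0⇒i≡0)}})

constant-bound : ∀ a c p {V C} → ∣ eval (c ∷ p) a ∣ ≤ V → ∣ eval p a ∣ ≤ C →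
                 ∣ c ∣ ≤ V ℕ.+ ∣ a ∣ ℕ.* C
constant-bound a c p {V} {C} cp≤V p≤C = begin
  ∣ c ∣                                        ≡⟨ cong ∣_∣ (regroup c (a * eval p a)) ⟩
  ∣ c + a * eval p a - a * eval p a ∣          ≤⟨ ℤ.∣i-j∣≤∣i∣+∣j∣ (c + a * eval p a) (a * eval p a) ⟩
  ∣ c + a * eval p a ∣ ℕ.+ ∣ a * eval p a ∣    ≡⟨ cong (∣ c + a * eval p a ∣ ℕ.+_)
                                                      (ℤ.abs-* a (eval p a)) ⟩
  ∣ c + a * eval p a ∣ ℕ.+ ∣ a ∣ ℕ.* ∣ eval p a ∣ ≤⟨ ℕ.+-mono-≤ cp≤V (ℕ.*-monoʳ-≤ ∣ a ∣ p≤C) ⟩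
  V ℕ.+ ∣ a ∣ ℕ.* C ∎
  where
  open ℕ.≤-Reasoning
  regroup : ∀ c u → c ≡ c + u - u
  regroup = solve-∀

-- For nonempty `p`, the value `eval p a` is the first entry of `quotient a p`.
∣eval∣≤ : ∀ a p {C} → All (λ c → ∣ c ∣ ≤ C) (quotient a p) → ∣ eval p a ∣ ≤ C
∣eval∣≤ a []      _       = z≤n
∣eval∣≤ a (c ∷ p) (b ∷ _) = b

bounded-quotient⇒bounded : ∀ a p {C} → All (λ c → ∣ c ∣ ≤ C) (quotient a p) →
                           All (λ c → ∣ c ∣ ≤ suc ∣ a ∣ ℕ.* C) p
bounded-quotient⇒bounded a []      _        = []
bounded-quotient⇒bounded a (c ∷ p) (b ∷ bs) =
  constant-bound a c p b (∣eval∣≤ a p bs) ∷ bounded-quotient⇒bounded a p bs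

-- The recursion of `many-roots⇒≡0` with bounds in place of zeros. Distinct integers differ by at
-- least 1, so dividing by `x - a` does not increase absolute values and the quotient is bounded by
-- `V + V` on the rest of `S`. Each coefficient of the tail has the form `q - a * q′` with entries
-- `q`, `q′` of the quotient, whence the factor `suc ∣ a ∣`.
coefficients-bounded : ∀ p {S V} → Unique S → All (λ x → ∣ eval p x ∣ ≤ V) S →
  length p ≤ length S → All (λ c → ∣ c ∣ ≤ interpolationBound S V) p
coefficients-bounded []      uS bounds len = []
coefficients-bounded (c ∷ p) {a ∷ S} {V} (a∉S ∷ uS) (ba ∷ bounds) (s≤s len) =
  ℕ.≤-trans (constant-bound a c p ba (∣eval∣≤ a p q≤C))
            (ℕ.+-monoʳ-≤ V (ℕ.*-monoˡ-≤ C (ℕ.n≤1+n ∣ a ∣))) ∷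
  All.map (λ b → ℕ.≤-trans b (ℕ.m≤n+m _ V)) (bounded-quotient⇒bounded a p q≤C)
  where
  C = interpolationBound S (V ℕ.+ V)
  bound : ∀ {x} → a ≢ x × ∣ eval (c ∷ p) x ∣ ≤ V → ∣ eval (quotient a p) x ∣ ≤ V ℕ.+ V
  bound {x} (a≢x , bx) = begin
    ∣ eval (quotient a p) x ∣              ≤⟨ ∣j∣≤∣i*j∣ (x - a) _ (a≢x ∘ sym ∘ ℤ.i-j≡0⇒i≡j x a) ⟩
    ∣ (x - a) * eval (quotient a p) x ∣    ≡⟨ cong ∣_∣ (eval-difference a c p x) ⟩
    ∣ eval (c ∷ p) x - eval (c ∷ p) a ∣    ≤⟨ ℤ.∣i-j∣≤∣i∣+∣j∣ (eval (c ∷ p) x) (eval (c ∷ p) a) ⟩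
    ∣ eval (c ∷ p) x ∣ ℕ.+ ∣ eval (c ∷ p) a ∣ ≤⟨ ℕ.+-mono-≤ bx ba ⟩
    V ℕ.+ V ∎
    where open ℕ.≤-Reasoning
  q≤C : All (λ c → ∣ c ∣ ≤ C) (quotient a p)
  q≤C = coefficients-bounded (quotient a p) uS (All.map bound (All.zip (a∉S , bounds)))
          (subst (_≤ length S) (sym (length-quotient a p)) len)

-- Linear systems over ℤ

infix 8 _·_

_·_ : ∀ {n} → Vec ℤ n → Vec ℤ n → ℤ
[]      · []      = 0ℤ
(x ∷ v) · (y ∷ w) = x * y + v · w

scale : ∀ {n} → ℤ → Vec ℤ n → Vec ℤ n
scale a = Vec.map (a *_)

·-scale : ∀ {n} a (v w : Vec ℤ n) → v · scale a w ≡ a * v · w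
·-scale a []      []      = sym (ℤ.*-zeroʳ a)
·-scale a (x ∷ v) (y ∷ w) = trans (cong (x * (a * y) +_) (·-scale a v w)) (regroup a x y (v · w))
  where
  regroup : ∀ a x y d → x * (a * y) + a * d ≡ a * (x * y + d)
  regroup = solve-∀

·-zeroʳ : ∀ {n} (v : Vec ℤ n) → v · Vec.replicate n 0ℤ ≡ 0ℤ
·-zeroʳ []      = refl
·-zeroʳ (x ∷ v) = cong₂ _+_ (ℤ.*-zeroʳ x) (·-zeroʳ v)

-- p v − h w: eliminates the first unknown between the equations h ∷ v and p ∷ w.
eliminate : ∀ {n} → ℤ → Vec ℤ n → Vec ℤ (suc n) → Vec ℤ n
eliminate p w (h ∷ v) = Vec.zipWith (λ x y → p * x - h * y) v w

·-zipWith : ∀ {n} p h (v w y : Vec ℤ n) →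
  Vec.zipWith (λ a b → p * a - h * b) v w · y ≡ p * v · y - h * w · y
·-zipWith p h []      []      []      = regroup p h
  where
  regroup : ∀ p h → 0ℤ ≡ p * 0ℤ - h * 0ℤ
  regroup = solve-∀
·-zipWith p h (a ∷ v) (b ∷ w) (c ∷ y) =
  trans (cong ((p * a - h * b) * c +_) (·-zipWith p h v w y))
        (regroup p h a b c (v · y) (w · y))
  where
  regroup : ∀ p h a b c d e →
    (p * a - h * b) * c + (p * d - h * e) ≡ p * (a * c + d) - h * (b * c + e)
  regroup = solve-∀

-- Solving the pivot equation `p ∷ w` for the first unknown would require division by `p`; scaling
-- the other unknowns by `p` instead keeps the solution integral.
back-substitute : ∀ {n} → ℤ → Vec ℤ n → Vec ℤ n → Vec ℤ (suc n)
back-substitute p w y = - (w · y) ∷ scale p y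

·-back-substitute : ∀ {n} p (w y : Vec ℤ n) r →
  r · back-substitute p w y ≡ eliminate p w r · y
·-back-substitute p w y (h ∷ v) = begin
  h * - (w · y) + v · scale p y    ≡⟨ cong (h * - (w · y) +_) (·-scale p v y) ⟩
  h * - (w · y) + p * v · y        ≡⟨ regroup h p (w · y) (v · y) ⟩
  p * v · y - h * w · y            ≡⟨ ·-zipWith p h v w y ⟨
  Vec.zipWith (λ a b → p * a - h * b) v w · y ∎
  where
  open ≡-Reasoning
  regroup : ∀ h p d e → h * - d + p * e ≡ p * e - h * d
  regroup = solve-∀

·-pivot : ∀ {n} p (w y : Vec ℤ n) → (p ∷ w) · back-substitute p w y ≡ 0ℤ
·-pivot p w y = trans (·-back-substitute p w y (p ∷ w))
  (trans (·-zipWith p p w w y) (ℤ.+-inverseʳ (p * w · y)))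

-- Fraction-free Gaussian elimination. If the first unknown occurs in no equation, the first unit
-- vector is a solution. Otherwise a pivot row removes one equation and one unknown, and the pivot
-- is nonzero, so scaling by it keeps the solution nonzero.
nontrivial-solution : ∀ {n} (rows : List (Vec ℤ n)) → length rows < n →
  ∃[ x ] (∃[ i ] lookup x i ≢ 0ℤ) × All (λ r → r · x ≡ 0ℤ) rows
nontrivial-solution {suc n} rows (s≤s len)
  with Any.any? (λ r → ¬? (head r ℤ.≟ 0ℤ)) rows
... | no ∄pivot = 1ℤ ∷ Vec.replicate n 0ℤ , (zero , λ ()) ,
  All.map (λ {r} → solves r) (All.¬Any⇒All¬ rows ∄pivot)
  where
  solves : ∀ r → _ → r · (1ℤ ∷ Vec.replicate n 0ℤ) ≡ 0ℤ
  solves (h ∷ v) ¬h≢0 = cong₂ _+_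
    (trans (ℤ.*-identityʳ h) (decidable-stable (h ℤ.≟ 0ℤ) ¬h≢0)) (·-zeroʳ v)
... | yes ∃pivot with find ∃pivot
... | p ∷ w , r∈rows , p≢0 with ∈-∃++ r∈rows
... | us , vs , refl =
  back-substitute p w y , (suc i , pyᵢ≢0) ,
  All.++⁺ (All.++⁻ˡ us others) (·-pivot p w y ∷ All.++⁻ʳ us others)
  where
  len′ : length (map (eliminate p w) (us ++ vs)) < n
  len′ = subst (_≤ n) (trans (List.length-++-sucʳ us (p ∷ w) vs)
           (cong suc (sym (List.length-map (eliminate p w) (us ++ vs))))) len
  solution = nontrivial-solution (map (eliminate p w) (us ++ vs)) len′
  y = proj₁ solution
  i = proj₁ (proj₁ (proj₂ solution))
  pyᵢ≢0 : lookup (scale p y) i ≢ 0ℤ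
  pyᵢ≢0 eq = [ p≢0 , proj₂ (proj₁ (proj₂ solution)) ]′ (ℤ.i*j≡0⇒i≡0∨j≡0 p
    (trans (sym (Vec.lookup-map i (p *_) y)) eq))
  others : All (λ r → r · back-substitute p w y ≡ 0ℤ) (us ++ vs)
  others = All.map (λ {r} e → trans (·-back-substitute p w y r) e)
    (All.map⁻ (proj₂ (proj₂ solution)))

-- Zeros of a polynomial in a box

length-cartesianProductWith : ∀ {a b c} {A : Set a} {B : Set b} {C : Set c}
  (f : A → B → C) xs ys → length (cartesianProductWith f xs ys) ≡ length xs ℕ.* length ys
length-cartesianProductWith f []       ys = refl
length-cartesianProductWith f (x ∷ xs) ys = trans (List.length-++ (map (f x) ys))
  (cong₂ ℕ._+_ (List.length-map (f x) ys) (length-cartesianProductWith f xs ys))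

module _ {a} {A : Set a} where

  vecs : List A → ∀ n → List (Vec A n)
  vecs S zero    = [] ∷ []
  vecs S (suc n) = cartesianProductWith _∷_ S (vecs S n)

  length-vecs : ∀ S n → length (vecs S n) ≡ length S ℕ.^ n
  length-vecs S zero    = refl
  length-vecs S (suc n) = trans (length-cartesianProductWith _∷_ S (vecs S n))
                                (cong (length S ℕ.*_) (length-vecs S n))

  vecs-unique : ∀ {S} → Unique S → ∀ n → Unique (vecs S n)
  vecs-unique uS zero    = [] ∷ []
  vecs-unique uS (suc n) =
    Unique.cartesianProductWith⁺ _∷_ Vec.∷-injective uS (vecs-unique uS n)

  ∈-vecs⁺ : ∀ {S n} {v : Vec A n} → VecAll.All (_∈ S) v → v ∈ vecs S n
  ∈-vecs⁺ []       = here refl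
  ∈-vecs⁺ (x ∷ xs) = ∈-cartesianProductWith⁺ _∷_ x (∈-vecs⁺ xs)

  ∈-vecs⁻ : ∀ S n {v : Vec A n} → v ∈ vecs S n → VecAll.All (_∈ S) v
  ∈-vecs⁻ S zero    {[]} _ = []
  ∈-vecs⁻ S (suc n) v∈ with ∈-cartesianProductWith⁻ _∷_ S (vecs S n) v∈
  ... | _ , _ , x∈S , w∈ , refl = x∈S ∷ ∈-vecs⁻ S n w∈

module _ {a b p q} {A : Set a} {B : Set b} {P : Pred B p} {Q : Pred A q}
         (P? : Decidable P) (Q? : Decidable Q) where

  length-filter-map-≤ : ∀ {f : A → B} → (∀ x → P (f x) → Q x) → ∀ xs →
    length (filter P? (map f xs)) ≤ length (filter Q? xs)
  length-filter-map-≤ {f} P⇒Q [] = z≤n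
  length-filter-map-≤ {f} P⇒Q (x ∷ xs) with P? (f x) | Q? x
  ... | yes _  | yes _  = s≤s (length-filter-map-≤ P⇒Q xs)
  ... | yes Px | no ¬Qx = contradiction (P⇒Q x Px) ¬Qx
  ... | no _   | yes _  = ℕ.m≤n⇒m≤1+n (length-filter-map-≤ P⇒Q xs)
  ... | no _   | no _   = length-filter-map-≤ P⇒Q xs

-- Formal sums of terms, as in ℂ[ n ] but with integer coefficients.
Terms : ℕ → Set
Terms n = List (ℤ × Vec ℕ n)

monomial : ∀ {n} → (Fin n → ℤ) → Vec ℕ n → ℤ
monomial z []      = 1ℤ
monomial z (j ∷ e) = z zero ^ j * monomial (z ∘ suc) e

evalT : ∀ {n} → Terms n → (Fin n → ℤ) → ℤ
evalT F z = foldr (λ (c , e) s → c * monomial z e + s) 0ℤ F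

infix 4 _≟ᵉ_
_≟ᵉ_ : ∀ {n} (e e′ : Vec ℕ n) → Dec (e ≡ e′)
_≟ᵉ_ = Vec.≡-dec ℕ._≟_

coeffT : ∀ {n} → Vec ℕ n → Terms n → ℤ
coeffT e = foldr (λ (c , e′) s → if does (e′ ≟ᵉ e) then c + s else s) 0ℤ

specialise : ∀ {n} → ℤ → Terms (suc n) → Terms n
specialise x = map (λ (c , e) → c * x ^ Vec.head e , Vec.tail e)

evalT-specialise : ∀ {n} x (F : Terms (suc n)) (v : Vec ℤ n) →
  evalT (specialise x F) (lookup v) ≡ evalT F (lookup (x ∷ v))
evalT-specialise x []                v = refl
evalT-specialise x ((c , j ∷ e) ∷ F) v =
  cong₂ _+_ (ℤ.*-assoc c (x ^ j) _) (evalT-specialise x F v)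

power : ℤ → ℕ → ℤ[x]
power c zero    = c ∷ []
power c (suc j) = 0ℤ ∷ power c j

eval-power : ∀ c j x → eval (power c j) x ≡ c * x ^ j
eval-power c zero    x = regroup c x
  where
  regroup : ∀ c x → c + x * 0ℤ ≡ c * 1ℤ
  regroup = solve-∀
eval-power c (suc j) x = trans (cong (λ y → 0ℤ + x * y) (eval-power c j x)) (regroup c x (x ^ j))
  where
  regroup : ∀ c x y → 0ℤ + x * (c * y) ≡ c * (x * y)
  regroup = solve-∀

coeff-power : ∀ c j n → coeff (power c j) n ≡ (if does (j ℕ.≟ n) then c else 0ℤ)
coeff-power c zero    zero    = refl
coeff-power c zero    (suc n) = refl
coeff-power c (suc j) zero    = refl
coeff-power c (suc j) (suc n) = coeff-power c j n

length-power : ∀ c j → length (power c j) ≡ suc j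
length-power c zero    = refl
length-power c (suc j) = cong suc (length-power c j)

coeff-+ : ∀ p q n → coeff (p +ₚ q) n ≡ coeff p n + coeff q n
coeff-+ []      q       n       = sym (ℤ.+-identityˡ _)
coeff-+ (a ∷ p) []      n       = sym (ℤ.+-identityʳ _)
coeff-+ (a ∷ p) (b ∷ q) zero    = refl
coeff-+ (a ∷ p) (b ∷ q) (suc n) = coeff-+ p q n

length-+ : ∀ p q {n} → length p ≤ n → length q ≤ n → length (p +ₚ q) ≤ n
length-+ []      q       p≤n       q≤n       = q≤n
length-+ (a ∷ p) []      p≤n       q≤n       = p≤n
length-+ (a ∷ p) (b ∷ q) (s≤s p≤n) (s≤s q≤n) = s≤s (length-+ p q p≤n q≤n)

-- The coefficient of x₂^e₁⋯xₙ₊₁^eₙ as a polynomial in x₁.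
section : ∀ {n} → Vec ℕ n → Terms (suc n) → ℤ[x]
section e = foldr (λ (c , e′) s →
  if does (Vec.tail e′ ≟ᵉ e) then power c (Vec.head e′) +ₚ s else s) []

eval-section : ∀ {n} e (F : Terms (suc n)) x → eval (section e F) x ≡ coeffT e (specialise x F)
eval-section e []                 x = refl
eval-section e ((c , j ∷ e′) ∷ F) x with does (e′ ≟ᵉ e)
... | false = eval-section e F x
... | true  = trans (eval-+ (power c j) (section e F) x)
                    (cong₂ _+_ (eval-power c j x) (eval-section e F x))

coeff-section : ∀ {n} e (F : Terms (suc n)) j → coeff (section e F) j ≡ coeffT (j ∷ e) F
coeff-section e []                  j = refl
coeff-section e ((c , j′ ∷ e′) ∷ F) j with does (e′ ≟ᵉ e) | coeff-power c j′ j
... | false | _ with does (j′ ℕ.≟ j)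
...   | true  = coeff-section e F j
...   | false = coeff-section e F j
coeff-section e ((c , j′ ∷ e′) ∷ F) j | true | eq with does (j′ ℕ.≟ j)
...   | true  = trans (coeff-+ (power c j′) (section e F) j) (cong₂ _+_ eq (coeff-section e F j))
...   | false = trans (coeff-+ (power c j′) (section e F) j)
                  (trans (cong₂ _+_ eq (coeff-section e F j)) (ℤ.+-identityˡ _))

ExponentsBelow : ∀ {n} → ℕ → Terms n → Set
ExponentsBelow N = All (λ (_ , e) → VecAll.All (_< N) e)

length-section : ∀ {n N} e {F : Terms (suc n)} → ExponentsBelow N F → length (section e F) ≤ N
length-section e [] = z≤n
length-section e {(c , j ∷ e′) ∷ F} ((j<N ∷ _) ∷ F<N) with does (e′ ≟ᵉ e)
... | false = length-section e F<N
... | true  = length-+ (power c j) (section e F)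
                (subst (_≤ _) (sym (length-power c j)) j<N) (length-section e F<N)

specialise-below : ∀ {n N} x {F : Terms (suc n)} → ExponentsBelow N F →
                   ExponentsBelow N (specialise x F)
specialise-below x = All.map⁺ ∘ All.map λ { {_ , _ ∷ _} (_ ∷ e<N) → e<N }

evalT-nullary : ∀ (F : Terms 0) z → evalT F z ≡ coeffT [] F
evalT-nullary []             z = refl
evalT-nullary ((c , []) ∷ F) z = cong₂ _+_ (ℤ.*-identityʳ c) (evalT-nullary F z)

zero? : ∀ {n} (F : Terms n) → Decidable (λ (v : Vec ℤ n) → evalT F (lookup v) ≡ 0ℤ)
zero? F v = evalT F (lookup v) ℤ.≟ 0ℤ

module _ {S : List ℤ} (uS : Unique S) (N : ℕ) where

  private s = length S

  -- Specialising the first variable kills the coefficient of x₂^e₁⋯xₙ₊₁^eₙ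
  -- for fewer than N of its values.
  schwartz-zippel : ∀ n (F : Terms n) → ExponentsBelow N F → ∀ e → coeffT e F ≢ 0ℤ →
    length (filter (zero? F) (vecs S n)) ℕ.* s ≤ n ℕ.* N ℕ.* s ℕ.^ n
  schwartz-zippel zero    F F<N []      Fₑ≢0 with evalT F (lookup []) ℤ.≟ 0ℤ
  ... | yes F≡0 = contradiction (trans (sym (evalT-nullary F (lookup []))) F≡0) Fₑ≢0
  ... | no  _   = z≤n
  schwartz-zippel (suc n) F F<N (j ∷ e) Fₑ≢0 = begin
    length (filter (zero? F) (vecs S (suc n))) ℕ.* s
      ≤⟨ fibres S ⟩
    length (filter bad? S) ℕ.* (s ℕ.^ n ℕ.* s) ℕ.+ s ℕ.* (n ℕ.* N ℕ.* s ℕ.^ n)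
      ≤⟨ ℕ.+-monoˡ-≤ _ (ℕ.*-monoˡ-≤ _ #bad≤N) ⟩
    N ℕ.* (s ℕ.^ n ℕ.* s) ℕ.+ s ℕ.* (n ℕ.* N ℕ.* s ℕ.^ n)
      ≡⟨ regroup n N s (s ℕ.^ n) ⟩
    suc n ℕ.* N ℕ.* s ℕ.^ suc n ∎
    where
    open ℕ.≤-Reasoning
    p = section e F
    bad? = λ x → eval p x ℤ.≟ 0ℤ
    #bad≤N : length (filter bad? S) ≤ N
    #bad≤N = ℕ.≤-trans
      (ℕ.<⇒≤ (root-count p {j} (subst (_≢ 0ℤ) (sym (coeff-section e F j)) Fₑ≢0) uS))
      (length-section e F<N)
    regroup : ∀ n N s t → N ℕ.* (t ℕ.* s) ℕ.+ s ℕ.* (n ℕ.* N ℕ.* t) ≡ suc n ℕ.* N ℕ.* (s ℕ.* t)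
    regroup = ℕ-Solver.solve-∀
    fibre : ∀ x → length (filter (zero? F) (map (x ∷_) (vecs S n))) ≤
                  length (filter (zero? (specialise x F)) (vecs S n))
    fibre x = length-filter-map-≤ (zero? F) (zero? (specialise x F))
      (λ v → trans (evalT-specialise x F v)) (vecs S n)
    total-fibre : ∀ x → length (filter (zero? F) (map (x ∷_) (vecs S n))) ≤ s ℕ.^ n
    total-fibre x = ℕ.≤-trans (List.length-filter (zero? F) (map (x ∷_) (vecs S n)))
      (ℕ.≤-reflexive (trans (List.length-map (x ∷_) (vecs S n)) (length-vecs S n)))
    -- The fibre over a root of `section e F` is counted in full, any other by the induction
    -- hypothesis on `n`. The induction runs over a separate list `X`, so that `s` stays the length
    -- of the whole of `S`.
    fibres : ∀ X → length (filter (zero? F) (cartesianProductWith _∷_ X (vecs S n))) ℕ.* s ≤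
      length (filter bad? X) ℕ.* (s ℕ.^ n ℕ.* s) ℕ.+ length X ℕ.* (n ℕ.* N ℕ.* s ℕ.^ n)
    fibres []      = z≤n
    fibres (x ∷ X) with fibres X
    ... | ih rewrite List.filter-++ (zero? F) (map (x ∷_) (vecs S n))
                       (cartesianProductWith _∷_ X (vecs S n))
                   | List.length-++ (filter (zero? F) (map (x ∷_) (vecs S n)))
                       {filter (zero? F) (cartesianProductWith _∷_ X (vecs S n))}
                   | ℕ.*-distribʳ-+ s (length (filter (zero? F) (map (x ∷_) (vecs S n))))
                       (length (filter (zero? F) (cartesianProductWith _∷_ X (vecs S n))))
        with bad? x
    ... | yes _    = ℕ.≤-trans (ℕ.+-mono-≤ (ℕ.*-monoˡ-≤ s (total-fibre x)) ih)
          (ℕ.≤-trans (ℕ.≤-reflexive (sym (ℕ.+-assoc (s ℕ.^ n ℕ.* s) _ _)))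
            (ℕ.+-monoʳ-≤ (s ℕ.^ n ℕ.* s ℕ.+ length (filter bad? X) ℕ.* (s ℕ.^ n ℕ.* s)) (ℕ.m≤n+m _ _)))
    ... | no  px≢0 = ℕ.≤-trans (ℕ.+-mono-≤ (ℕ.≤-trans (ℕ.*-monoˡ-≤ s (fibre x))
            (schwartz-zippel n (specialise x F) (specialise-below x F<N) e
              (px≢0 ∘ trans (eval-section e F x)))) ih)
          (ℕ.≤-reflexive (swap (n ℕ.* N ℕ.* s ℕ.^ n) (length (filter bad? X) ℕ.* (s ℕ.^ n ℕ.* s)) _))
      where
      swap : ∀ a b c → a ℕ.+ (b ℕ.+ c) ≡ b ℕ.+ (a ℕ.+ c)
      swap = ℕ-Solver.solve-∀

-- Polynomial functions vanishing on a grid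

length-* : ∀ (p q : ℤ[x]) {D E} → length p ≤ suc D → length q ≤ suc E →
                       length (p *ₚ q) ≤ suc (D ℕ.+ E)
length-* []           q {D}     p≤ q≤ = z≤n
-- Singletons are treated apart because `D` may be 0 there; with two or more coefficients `D` is a
-- successor, which pays for the shift by `x`.
length-* (a ∷ [])     q {D}     p≤ q≤ = length-+ (map (a *_) q) (0ℤ ∷ [])
  (ℕ.≤-trans (ℕ.≤-reflexive (List.length-map (a *_) q)) (ℕ.≤-trans q≤ (s≤s (ℕ.m≤n+m _ D)))) (s≤s z≤n)
length-* (a ∷ b ∷ p) q {suc D} (s≤s p≤) q≤ = length-+ (map (a *_) q) (0ℤ ∷ (b ∷ p) *ₚ q)
  (ℕ.≤-trans (ℕ.≤-reflexive (List.length-map (a *_) q)) (ℕ.≤-trans q≤ (s≤s (ℕ.m≤n+m _ (suc D)))))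
  (s≤s (length-* (b ∷ p) q p≤ q≤))

Degree≤ : ℕ → (ℤ → ℤ) → Set
Degree≤ D g = ∃[ p ] length p ≤ suc D × (∀ x → g x ≡ eval p x)

-- The one-variable polynomials may depend on the remaining arguments in any way whatever. The grid
-- argument asks for no more, and no normal form of polynomials in several variables is involved.
DegreeInEach≤ : ∀ m → ℕ → (Vec ℤ m → ℤ) → Set
DegreeInEach≤ zero    D G = ⊤
DegreeInEach≤ (suc m) D G =
  (∀ y → Degree≤ D (λ x → G (x ∷ y))) × (∀ x → DegreeInEach≤ m D (λ y → G (x ∷ y)))

const-polynomial : ∀ m c {D} → DegreeInEach≤ m D (λ _ → c)
const-polynomial zero    c = tt
const-polynomial (suc m) c = (λ _ → c ∷ [] , s≤s z≤n , constant c) , λ _ → const-polynomial m c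
  where
  constant : ∀ c x → c ≡ c + x * 0ℤ
  constant = solve-∀

weaken : ∀ m {D E} → D ≤ E → ∀ {G} → DegreeInEach≤ m D G → DegreeInEach≤ m E G
weaken zero    D≤E _       = tt
weaken (suc m) D≤E (u , v) =
  (λ y → case u y of λ (p , p≤ , eq) → p , ℕ.≤-trans p≤ (s≤s D≤E) , eq) , λ x → weaken m D≤E (v x)

resp-≗ : ∀ m {D G H} → (∀ t → G t ≡ H t) → DegreeInEach≤ m D G → DegreeInEach≤ m D H
resp-≗ zero    G≡H _       = tt
resp-≗ (suc m) G≡H (u , v) =
  (λ y → case u y of λ (p , p≤ , eq) → p , p≤ , λ x → trans (sym (G≡H (x ∷ y))) (eq x)) ,
  λ x → resp-≗ m (G≡H ∘ (x ∷_)) (v x)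

+-polynomial : ∀ m {D G H} → DegreeInEach≤ m D G → DegreeInEach≤ m D H →
               DegreeInEach≤ m D (λ t → G t + H t)
+-polynomial zero    _       _         = tt
+-polynomial (suc m) (u , v) (u′ , v′) =
  (λ y → case u y , u′ y of λ ((p , p≤ , eq) , (q , q≤ , eq′)) →
     p +ₚ q , length-+ p q p≤ q≤ , λ x → trans (cong₂ _+_ (eq x) (eq′ x)) (sym (eval-+ p q x))) ,
  λ x → +-polynomial m (v x) (v′ x)

*-polynomial : ∀ m {D E G H} → DegreeInEach≤ m D G → DegreeInEach≤ m E H →
               DegreeInEach≤ m (D ℕ.+ E) (λ t → G t * H t)
*-polynomial zero    _       _         = tt
*-polynomial (suc m) (u , v) (u′ , v′) =
  (λ y → case u y , u′ y of λ ((p , p≤ , eq) , (q , q≤ , eq′)) →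
     p *ₚ q , length-* p q p≤ q≤ , λ x → trans (cong₂ _*_ (eq x) (eq′ x)) (sym (eval-* p q x))) ,
  λ x → *-polynomial m (v x) (v′ x)

^-polynomial : ∀ m {D G} → DegreeInEach≤ m D G → ∀ j → DegreeInEach≤ m (j ℕ.* D) (λ t → G t ^ j)
^-polynomial m G zero    = const-polynomial m 1ℤ
^-polynomial m G (suc j) = *-polynomial m G (^-polynomial m G j)

monomial-polynomial : ∀ m {D N n} {z : Vec ℤ m → Fin n → ℤ} →
  (∀ i → DegreeInEach≤ m D (λ t → z t i)) → ∀ {e} → VecAll.All (_< N) e →
  DegreeInEach≤ m (n ℕ.* (N ℕ.* D)) (λ t → monomial (z t) e)
monomial-polynomial m         zi []          = const-polynomial m 1ℤ
monomial-polynomial m {D} zi {j ∷ e} (j<N ∷ e<N) = *-polynomial m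
  (weaken m (ℕ.*-monoˡ-≤ D (ℕ.<⇒≤ j<N)) (^-polynomial m (zi zero) j))
  (monomial-polynomial m (zi ∘ suc) e<N)

evalT-polynomial : ∀ m {D N n} {z : Vec ℤ m → Fin n → ℤ} →
  (∀ i → DegreeInEach≤ m D (λ t → z t i)) → ∀ F → ExponentsBelow N F →
  DegreeInEach≤ m (n ℕ.* (N ℕ.* D)) (λ t → evalT F (z t))
evalT-polynomial m zi []            []          = const-polynomial m 0ℤ
evalT-polynomial m zi ((c , e) ∷ F) (e<N ∷ F<N) = +-polynomial m
  (*-polynomial m {0} (const-polynomial m c) (monomial-polynomial m zi e<N))
  (evalT-polynomial m zi F F<N)

-- For a first coordinate in `S` the induction hypothesis gives vanishing at all `y`; for fixed `y`
-- the first coordinate then has more roots than the degree.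
vanishes-on-grid⇒≡0 : ∀ m {D G} → DegreeInEach≤ m D G → ∀ {S} → Unique S → D < length S →
  (∀ {t} → t ∈ vecs S m → G t ≡ 0ℤ) → ∀ t → G t ≡ 0ℤ
vanishes-on-grid⇒≡0 zero    _       uS D<S G≡0 [] = G≡0 (here refl)
vanishes-on-grid⇒≡0 (suc m) {D} {G} (u , v) {S} uS D<S G≡0 (x ∷ y) with u y
... | p , p≤ , eq = trans (eq x) (coeff≡0⇒eval≡0 p
        (many-roots⇒≡0 p uS (All.tabulate root) (ℕ.≤-trans p≤ D<S)) x)
  where
  root : ∀ {a} → a ∈ S → eval p a ≡ 0ℤ
  root {a} a∈S = trans (sym (eq a))
    (vanishes-on-grid⇒≡0 m (v a) uS D<S (G≡0 ∘ ∈-cartesianProductWith⁺ _∷_ a∈S) y)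

-- Factorisations

-- The Cauchy product, on sequences rather than lists, so that a factor can be exchanged for another
-- with the same coefficients but different trailing zeros.
convolution : (ℕ → ℤ) → (ℕ → ℤ) → ℕ → ℤ
convolution u v zero    = u 0 * v 0
convolution u v (suc n) = u 0 * v (suc n) + convolution (u ∘ suc) v n

convolution-cong : ∀ {u u′ v v′} → (∀ n → u n ≡ u′ n) → (∀ n → v n ≡ v′ n) →
                   ∀ n → convolution u v n ≡ convolution u′ v′ n
convolution-cong u≡ v≡ zero    = cong₂ _*_ (u≡ 0) (v≡ 0)
convolution-cong u≡ v≡ (suc n) =
  cong₂ _+_ (cong₂ _*_ (u≡ 0) (v≡ (suc n))) (convolution-cong (u≡ ∘ suc) v≡ n)

convolution-zeroˡ : ∀ v n → convolution (λ _ → 0ℤ) v n ≡ 0ℤ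
convolution-zeroˡ v zero    = refl
convolution-zeroˡ v (suc n) = trans (ℤ.+-identityˡ _) (convolution-zeroˡ v n)

convolution-scale : ∀ a b u v n →
  convolution (λ i → a * u i) (λ i → b * v i) n ≡ a * b * convolution u v n
convolution-scale a b u v zero    = regroup a b (u 0) (v 0)
  where
  regroup : ∀ a b x y → a * x * (b * y) ≡ a * b * (x * y)
  regroup = solve-∀
convolution-scale a b u v (suc n) =
  trans (cong (a * u 0 * (b * v (suc n)) +_) (convolution-scale a b (u ∘ suc) v n))
        (regroup a b (u 0) (v (suc n)) _)
  where
  regroup : ∀ a b x y z → a * x * (b * y) + a * b * z ≡ a * b * (x * y + z)
  regroup = solve-∀

coeff-scale : ∀ a p n → coeff (map (a *_) p) n ≡ a * coeff p n
coeff-scale a []      n       = sym (ℤ.*-zeroʳ a)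
coeff-scale a (c ∷ p) zero    = refl
coeff-scale a (c ∷ p) (suc n) = coeff-scale a p n

coeff-* : ∀ p q n → coeff (p *ₚ q) n ≡ convolution (coeff p) (coeff q) n
coeff-* []      q n       = sym (convolution-zeroˡ (coeff q) n)
coeff-* (a ∷ p) q n       = trans (coeff-+ (map (a *_) q) (0ℤ ∷ p *ₚ q) n) (shifted n)
  where
  shifted : ∀ n → coeff (map (a *_) q) n + coeff (0ℤ ∷ p *ₚ q) n ≡
            convolution (coeff (a ∷ p)) (coeff q) n
  shifted zero    = trans (ℤ.+-identityʳ _) (coeff-scale a q 0)
  shifted (suc n) = cong₂ _+_ (coeff-scale a q (suc n)) (coeff-* p q n)

convolution-constant : ∀ a v n → convolution (coeff (a ∷ [])) v n ≡ a * v n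
convolution-constant a v zero    = refl
convolution-constant a v (suc n) =
  trans (cong (a * v (suc n) +_) (convolution-zeroˡ v n)) (ℤ.+-identityʳ _)

-- From index `length p + e` on, the entries of `p` meet only entries of `v` beyond `e`, which
-- vanish; what remains is the contribution of `a`.
leading-convolution : ∀ p a v e → (∀ n → e < n → v n ≡ 0ℤ) →
  convolution (coeff (p ++ [ a ])) v (length p ℕ.+ e) ≡ a * v e ×
  (∀ n → length p ℕ.+ e < n → convolution (coeff (p ++ [ a ])) v n ≡ 0ℤ)
leading-convolution []      a v e v≡0 = convolution-constant a v e , λ n e<n →
  trans (convolution-constant a v n) (trans (cong (a *_) (v≡0 n e<n)) (ℤ.*-zeroʳ a))
leading-convolution (c ∷ p) a v e v≡0 with leading-convolution p a v e v≡0
... | top , above = trans (first (length p ℕ.+ e) (s≤s (ℕ.m≤n+m e (length p)))) top ,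
  λ { (suc n) (s≤s l) → trans (first n (s≤s (ℕ.≤-trans (ℕ.m≤n+m e _) (ℕ.<⇒≤ l)))) (above n l) }
  where
  first : ∀ n → e < suc n → c * v (suc n) + convolution (coeff (p ++ [ a ])) v n ≡
          convolution (coeff (p ++ [ a ])) v n
  first n e<n = trans
    (cong (_+ rest) (trans (cong (c *_) (v≡0 (suc n) e<n)) (ℤ.*-zeroʳ c))) (ℤ.+-identityˡ rest)
    where rest = convolution (coeff (p ++ [ a ])) v n

coeff-last : ∀ p a → coeff (p ++ [ a ]) (length p) ≡ a
coeff-last []      a = refl
coeff-last (c ∷ p) a = coeff-last p a

coeff-beyond : ∀ p n → length p ≤ n → coeff p n ≡ 0ℤ
coeff-beyond []      n       _         = refl
coeff-beyond (c ∷ p) (suc n) (s≤s len) = coeff-beyond p n len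

ℕ-cases : ∀ {P : ℕ → Set} → P 0 → (∀ n → P (suc n)) → ∀ n → P n
ℕ-cases p₀ p₊ zero    = p₀
ℕ-cases p₀ p₊ (suc n) = p₊ n

-- Trailing zeros hide the degree; once they are cut, `q ++ [ a ]` has degree `length q` and leading
-- coefficient `a`.
trim : ∀ p → (∀ n → coeff p n ≡ 0ℤ) ⊎
             ∃₂ λ q a → a ≢ 0ℤ × (∀ n → coeff p n ≡ coeff (q ++ [ a ]) n)
trim []      = inj₁ λ _ → refl
trim (c ∷ p) with trim p
... | inj₂ (q , a , a≢0 , p≡q) = inj₂ (c ∷ q , a , a≢0 , ℕ-cases refl p≡q)
... | inj₁ p≡0 with c ℤ.≟ 0ℤ
...   | yes c≡0 = inj₁ (ℕ-cases c≡0 p≡0)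
...   | no  c≢0 = inj₂ ([] , c , c≢0 , ℕ-cases refl p≡0)

IsSign : ℤ → Set
IsSign ε = ε ≡ 1ℤ ⊎ ε ≡ -1ℤ

sign² : ∀ {ε} → IsSign ε → ε * ε ≡ 1ℤ
sign² (inj₁ refl) = refl
sign² (inj₂ refl) = refl

sign-* : ∀ {ε η} → IsSign ε → IsSign η → IsSign (ε * η)
sign-* (inj₁ refl) (inj₁ refl) = inj₁ refl
sign-* (inj₁ refl) (inj₂ refl) = inj₂ refl
sign-* (inj₂ refl) (inj₁ refl) = inj₂ refl
sign-* (inj₂ refl) (inj₂ refl) = inj₁ refl

∣i∣≡1⇒sign : ∀ i → ∣ i ∣ ≡ 1 → IsSign i
∣i∣≡1⇒sign (ℤ.+ 1)      refl = inj₁ refl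
∣i∣≡1⇒sign (ℤ.-[1+ 0 ]) refl = inj₂ refl

i*j≡1⇒∣i∣≡1 : ∀ i j → i * j ≡ 1ℤ → ∣ i ∣ ≡ 1
i*j≡1⇒∣i∣≡1 i j ij≡1 = ℕ.m*n≡1⇒m≡1 ∣ i ∣ ∣ j ∣ (trans (sym (ℤ.abs-* i j)) (cong ∣_∣ ij≡1))

i*j≡1⇒sign : ∀ i j → i * j ≡ 1ℤ → IsSign i × i ≡ j
i*j≡1⇒sign i j ij≡1 with ∣i∣≡1⇒sign i (i*j≡1⇒∣i∣≡1 i j ij≡1)
... | inj₁ refl = inj₁ refl , trans (sym ij≡1) (ℤ.*-identityˡ j)
... | inj₂ refl = inj₂ refl , trans (trans (cong -_ (sym ij≡1)) (regroup j)) refl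
  where
  regroup : ∀ j → - (-1ℤ * j) ≡ j
  regroup = solve-∀

monicWith : ℤ → List ℤ → ℤ[x]
monicWith ε b = ε ∷ b ++ [ 1ℤ ]

-- The candidate factors have degrees k + 1 and m − k + 1 and the same constant
-- coefficient ε; t lists their m other coefficients.
candidate : ℤ → ℕ → List ℤ → ℤ[x]
candidate ε k t = monicWith ε (take k t) *ₚ monicWith ε (drop k t)

vector-of-length : ∀ {a} {A : Set a} {m} (xs : List A) → length xs ≡ m →
                   ∃[ v ] toList {n = m} v ≡ xs
vector-of-length []       refl = [] , refl
vector-of-length (x ∷ xs) refl = case vector-of-length xs refl of λ
  (v , eq) → x ∷ v , cong (x ∷_) eq

take-length-++ : ∀ {a} {A : Set a} (xs ys : List A) → take (length xs) (xs ++ ys) ≡ xs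
take-length-++ []       ys = refl
take-length-++ (x ∷ xs) ys = cong (x ∷_) (take-length-++ xs ys)

drop-length-++ : ∀ {a} {A : Set a} (xs ys : List A) → drop (length xs) (xs ++ ys) ≡ ys
drop-length-++ []       ys = refl
drop-length-++ (x ∷ xs) ys = drop-length-++ xs ys

constant-sign⇒unit : ∀ {g a} → (∀ n → coeff g n ≡ coeff [ a ] n) → IsSign a → Unit g
constant-sign⇒unit {g} {a} g≡a s = [ a ] RawMagma., mk≈ₚ λ n → begin
  coeff ([ a ] *ₚ g) n              ≡⟨ coeff-* [ a ] g n ⟩
  convolution (coeff [ a ]) (coeff g) n ≡⟨ convolution-constant a (coeff g) n ⟩
  a * coeff g n                     ≡⟨ cong (a *_) (g≡a n) ⟩
  a * coeff [ a ] n                 ≡⟨ square n ⟩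
  coeff [ 1ℤ ] n                    ∎
  where
  open ≡-Reasoning
  square : ∀ n → a * coeff [ a ] n ≡ coeff [ 1ℤ ] n
  square zero    = sign² s
  square (suc n) = ℤ.*-zeroʳ a

scale-monicWith : ∀ {s} → IsSign s → ∀ c b →
  map (s *_) (c ∷ b ++ [ s ]) ≡ monicWith (s * c) (map (s *_) b)
scale-monicWith {s} sign c b = cong (s * c ∷_)
  (trans (List.map-++ (s *_) b [ s ]) (cong (λ x → map (s *_) b ++ [ x ]) (sign² sign)))

module _ {m f} (f-degree : ∀ n → suc (suc m) < n → coeff f n ≡ 0ℤ)
         (f-monic : coeff f (suc (suc m)) ≡ 1ℤ) (f-constant : coeff f 0 ≡ 1ℤ) where

  -- The leading coefficients of the factors have product 1, so they are one common sign `s`, and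
  -- likewise the constant coefficients agree. Multiplying both factors by `s` makes them monic and
  -- leaves the product unchanged, since `s * s = 1`.
  reducible⇒candidate : Reducible f → ∃[ ε ] ∃[ k ] ∃[ t ]
    IsSign ε × k ≤ m × (∀ n → coeff f n ≡ coeff (candidate ε k (toList {n = m} t)) n)
  reducible⇒candidate (g , h , mk≈ₚ f≡gh , ¬unit-g , ¬unit-h) = factored (trim g) (trim h)
    where
    Result = ∃[ ε ] ∃[ k ] ∃[ t ]
      IsSign ε × k ≤ m × (∀ n → coeff f n ≡ coeff (candidate ε k (toList {n = m} t)) n)
    f≡conv : ∀ n → coeff f n ≡ convolution (coeff g) (coeff h) n
    f≡conv n = trans (f≡gh n) (coeff-* g h n)
    constants : coeff g 0 * coeff h 0 ≡ 1ℤ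
    constants = trans (sym (f≡conv 0)) f-constant
    0≢1 : ∀ {x} → x ≡ 0ℤ → x ≡ 1ℤ → ∀ {a} {A : Set a} → A
    0≢1 refl ()
    factored : _ → _ → Result
    factored (inj₁ g≡0) _ = 0≢1 (cong (_* coeff h 0) (g≡0 0)) constants
    factored _ (inj₁ h≡0) = 0≢1 (trans (cong (coeff g 0 *_) (h≡0 0)) (ℤ.*-zeroʳ (coeff g 0))) constants
    factored (inj₂ (g′ , a , a≢0 , g≡)) (inj₂ (h′ , b , b≢0 , h≡)) =
      by-degree (ℕ.<-cmp (length g′ ℕ.+ length h′) (suc (suc m)))
      where
      f≡conv′ : ∀ n → coeff f n ≡ convolution (coeff (g′ ++ [ a ])) (coeff (h′ ++ [ b ])) n
      f≡conv′ n = trans (f≡conv n) (convolution-cong g≡ h≡ n)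
      leading = leading-convolution g′ a (coeff (h′ ++ [ b ])) (length h′)
        λ n l → coeff-beyond (h′ ++ [ b ]) n
          (subst (_≤ n) (sym (trans (List.length-++ h′) (ℕ.+-comm (length h′) 1))) l)
      f-leading : coeff f (length g′ ℕ.+ length h′) ≡ a * b
      f-leading = trans (f≡conv′ _) (trans (proj₁ leading) (cong (a *_) (coeff-last h′ b)))
      normalise : ∀ {g₀ h₀ s} g″ h″ →
        (∀ n → coeff g n ≡ coeff (g₀ ∷ g″ ++ [ s ]) n) →
        (∀ n → coeff h n ≡ coeff (h₀ ∷ h″ ++ [ s ]) n) →
        IsSign s → length g″ ℕ.+ length h″ ≡ m → Result
      normalise {g₀} {h₀} {s} g″ h″ g≡ h≡ sign len
        with i*j≡1⇒sign g₀ h₀ (trans (sym (cong₂ _*_ (g≡ 0) (h≡ 0))) constants)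
           | vector-of-length (map (s *_) g″ ++ map (s *_) h″)
               (trans (List.length-++ (map (s *_) g″))
                 (trans (cong₂ ℕ._+_ (List.length-map _ g″) (List.length-map _ h″)) len))
      ... | sign₀ , refl | t , eq = s * g₀ , length (map (s *_) g″) , t , sign-* sign sign₀ ,
        subst (_≤ m) (sym (List.length-map _ g″)) (subst (length g″ ≤_) len (ℕ.m≤m+n _ _)) ,
        λ n → begin
          coeff f n
            ≡⟨ f≡conv n ⟩
          convolution (coeff g) (coeff h) n
            ≡⟨ ℤ.*-identityˡ _ ⟨
          1ℤ * convolution (coeff g) (coeff h) n
            ≡⟨ cong (_* convolution (coeff g) (coeff h) n) (sign² sign) ⟨
          s * s * convolution (coeff g) (coeff h) n
            ≡⟨ convolution-scale s s (coeff g) (coeff h) n ⟨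
          convolution (λ i → s * coeff g i) (λ i → s * coeff h i) n
            ≡⟨ convolution-cong (scaled g g≡) (scaled h h≡) n ⟩
          convolution (coeff (monicWith (s * g₀) (map (s *_) g″)))
                      (coeff (monicWith (s * g₀) (map (s *_) h″))) n
            ≡⟨ coeff-* (monicWith (s * g₀) (map (s *_) g″)) (monicWith (s * g₀) (map (s *_) h″)) n ⟨
          coeff (monicWith (s * g₀) (map (s *_) g″) *ₚ monicWith (s * g₀) (map (s *_) h″)) n
            ≡⟨ cong₂ (λ x y → coeff (monicWith (s * g₀) x *ₚ monicWith (s * g₀) y) n)
                 (trans (cong (take k) eq) (take-length-++ (map (s *_) g″) (map (s *_) h″)))
                 (trans (cong (drop k) eq) (drop-length-++ (map (s *_) g″) (map (s *_) h″))) ⟨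
          coeff (candidate (s * g₀) (length (map (s *_) g″)) (toList t)) n ∎
        where
        open ≡-Reasoning
        k = length (map (s *_) g″)
        scaled : ∀ p {c q} → (∀ n → coeff p n ≡ coeff (c ∷ q ++ [ s ]) n) →
          ∀ n → s * coeff p n ≡ coeff (monicWith (s * c) (map (s *_) q)) n
        scaled p {c} {q} p≡ n = trans (cong (s *_) (p≡ n))
          (trans (sym (coeff-scale s (c ∷ q ++ [ s ]) n))
                 (cong (λ r → coeff r n) (scale-monicWith sign c q)))
      equal-degree : ∀ g′ h′ → (∀ n → coeff g n ≡ coeff (g′ ++ [ a ]) n) →
        (∀ n → coeff h n ≡ coeff (h′ ++ [ a ]) n) → IsSign a →
        length g′ ℕ.+ length h′ ≡ suc (suc m) → Result
      -- A factor of degree 0 is its own leading coefficient, a sign, hence a unit.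
      equal-degree []        h′        g≡ h≡ sign eq = contradiction (constant-sign⇒unit g≡ sign) ¬unit-g
      equal-degree (g₀ ∷ g″) []        g≡ h≡ sign eq = contradiction (constant-sign⇒unit h≡ sign) ¬unit-h
      equal-degree (g₀ ∷ g″) (h₀ ∷ h″) g≡ h≡ sign eq = normalise g″ h″ g≡ h≡ sign
        (ℕ.suc-injective (trans (sym (ℕ.+-suc (length g″) (length h″))) (ℕ.suc-injective eq)))
      by-degree : _ → Result
      -- The product has degree exactly `length g′ + length h′`: a smaller one contradicts
      -- `f-monic`, a larger one would force `a * b` to vanish by `f-degree`.
      by-degree (tri< l _ _) = 0≢1 (trans (f≡conv′ _) (proj₂ leading _ l)) f-monic
      by-degree (tri> _ _ l) = contradiction (trans (sym f-leading) (f-degree _ l))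
        λ ab≡0 → [ a≢0 , b≢0 ]′ (ℤ.i*j≡0⇒i≡0∨j≡0 a ab≡0)
      by-degree (tri≈ _ eq _) with i*j≡1⇒sign a b
        (trans (sym f-leading) (trans (cong (coeff f) eq) f-monic))
      ... | sign , refl = equal-degree g′ h′ g≡ h≡ sign eq

take-polynomial : ∀ m k n → DegreeInEach≤ m 1 (λ t → coeff (take k (toList t) ++ [ 1ℤ ]) n)
take-polynomial zero    k       n = tt
take-polynomial (suc m) zero    n = const-polynomial (suc m) (coeff [ 1ℤ ] n)
take-polynomial (suc m) (suc k) zero =
  (λ _ → 0ℤ ∷ 1ℤ ∷ [] , s≤s (s≤s z≤n) , regroup) , λ x → const-polynomial m x
  where
  regroup : ∀ x → x ≡ 0ℤ + x * (1ℤ + x * 0ℤ)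
  regroup = solve-∀
take-polynomial (suc m) (suc k) (suc n) =
  (λ y → proj₁ (const-polynomial (suc m) (coeff (take k (toList y) ++ [ 1ℤ ]) n)) y) ,
  λ _ → take-polynomial m k n

drop-polynomial : ∀ m k n → DegreeInEach≤ m 1 (λ t → coeff (drop k (toList t) ++ [ 1ℤ ]) n)
drop-polynomial zero    k       n = tt
-- Dropping nothing leaves the whole list, which is also what taking `suc m` entries leaves.
drop-polynomial (suc m) zero    n = resp-≗ (suc m)
  (λ t → cong (λ l → coeff (l ++ [ 1ℤ ]) n)
    (List.take-all (suc m) (toList t) (ℕ.≤-reflexive (Vec.length-toList t))))
  (take-polynomial (suc m) (suc m) n)

drop-polynomial (suc m) (suc k) n =
  (λ y → proj₁ (const-polynomial (suc m) (coeff (drop k (toList y) ++ [ 1ℤ ]) n)) y) ,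
  λ _ → drop-polynomial m k n

monicWith-polynomial : ∀ m {ε} (b : Vec ℤ m → List ℤ) →
  (∀ n → DegreeInEach≤ m 1 (λ t → coeff (b t ++ [ 1ℤ ]) n)) →
  ∀ n → DegreeInEach≤ m 1 (λ t → coeff (monicWith ε (b t)) n)
monicWith-polynomial m {ε} b bₙ zero    = const-polynomial m ε
monicWith-polynomial m     b bₙ (suc n) = bₙ n

convolution-polynomial : ∀ m {D E} (u v : Vec ℤ m → ℕ → ℤ) →
  (∀ n → DegreeInEach≤ m D (λ t → u t n)) → (∀ n → DegreeInEach≤ m E (λ t → v t n)) →
  ∀ n → DegreeInEach≤ m (D ℕ.+ E) (λ t → convolution (u t) (v t) n)
convolution-polynomial m u v uₙ vₙ zero    = *-polynomial m (uₙ 0) (vₙ 0)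
convolution-polynomial m u v uₙ vₙ (suc n) = +-polynomial m (*-polynomial m (uₙ 0) (vₙ (suc n)))
  (convolution-polynomial m (λ t → u t ∘ suc) v (uₙ ∘ suc) vₙ n)

-- The bound 2 is 1 + 1, one for each factor. It is crude, as every parameter enters only one of the
-- two factors, but it spares following the split at `k`.
candidate-polynomial : ∀ m ε k n → DegreeInEach≤ m 2 (λ t → coeff (candidate ε k (toList t)) n)
candidate-polynomial m ε k n = resp-≗ m (λ t → sym (coeff-* (g t) (h t) n))
  (convolution-polynomial m (λ t → coeff (g t)) (λ t → coeff (h t))
    (monicWith-polynomial m (λ t → take k (toList t)) (take-polynomial m k))
    (monicWith-polynomial m (λ t → drop k (toList t)) (drop-polynomial m k)) n)
  where
  g h : Vec ℤ m → ℤ[x]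
  g t = monicWith ε (take k (toList t))
  h t = monicWith ε (drop k (toList t))

-- Deciding reducibility, and the cardinalities

height : List ℤ → ℕ
height []      = 0
height (c ∷ p) = ∣ c ∣ ℕ.+ height p

bounded-by-height : ∀ p → All (λ c → ∣ c ∣ ≤ height p) p
bounded-by-height []      = []
bounded-by-height (c ∷ p) = ℕ.m≤m+n ∣ c ∣ (height p) ∷
  All.map (λ b → ℕ.≤-trans b (ℕ.m≤n+m _ ∣ c ∣)) (bounded-by-height p)

∣i∣≤n⇒-n≤i : ∀ i {n} → ∣ i ∣ ≤ n → - (ℤ.+ n) ℤ.≤ i
∣i∣≤n⇒-n≤i (ℤ.+ m)      {n}     _         = ℤ.neg-≤-pos {n}
∣i∣≤n⇒-n≤i (ℤ.-[1+ m ]) {suc n} (s≤s m≤n) = ℤ.-≤- m≤n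

horner-≥ : ∀ c {n x e} → ∣ c ∣ ≤ n → 1ℤ ℤ.≤ e → ℤ.+ x - ℤ.+ n ℤ.≤ c + ℤ.+ x * e
horner-≥ c {n} {x} {e} c≤n 1≤e = begin
  ℤ.+ x - ℤ.+ n            ≡⟨ ℤ.+-comm (ℤ.+ x) (- ℤ.+ n) ⟩
  - ℤ.+ n + ℤ.+ x          ≡⟨ cong (- ℤ.+ n +_) (ℤ.*-identityʳ (ℤ.+ x)) ⟨
  - ℤ.+ n + ℤ.+ x * 1ℤ     ≤⟨ ℤ.+-mono-≤ (∣i∣≤n⇒-n≤i c c≤n) (ℤ.*-monoˡ-≤-nonNeg (ℤ.+ x) 1≤e) ⟩
  c + ℤ.+ x * e            ∎
  where open ℤ.≤-Reasoning

-- Horner evaluation starts from the leading 1, and each later stage `c + x * e` with `e ≥ 1` is at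
-- least `x - n ≥ 1`.
monic-eval-≥1 : ∀ b {n x} → All (λ c → ∣ c ∣ ≤ n) b → n < x → 1ℤ ℤ.≤ eval (b ++ [ 1ℤ ]) (ℤ.+ x)
monic-eval-≥1 []      {x = x} []       n<x = ℤ.≤-reflexive (regroup (ℤ.+ x))
  where
  regroup : ∀ x → 1ℤ ≡ 1ℤ + x * 0ℤ
  regroup = solve-∀
monic-eval-≥1 (c ∷ b) {n} {x} (c≤ ∷ b≤) n<x = ℤ.≤-trans
  (ℤ.≤-trans (ℤ.+≤+ (ℕ.m<n⇒0<n∸m n<x))
    (ℤ.≤-reflexive (trans (sym (ℤ.⊖-≥ (ℕ.<⇒≤ n<x))) (sym (ℤ.m-n≡m⊖n x n)))))
  (horner-≥ c c≤ (monic-eval-≥1 b b≤ n<x))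

sign-abs : ∀ {ε} → IsSign ε → ∣ ε ∣ ≤ 1
sign-abs (inj₁ refl) = ℕ.≤-refl
sign-abs (inj₂ refl) = ℕ.≤-refl

2≤i⇒∣i∣≢1 : ∀ {i} → ℤ.+ 2 ℤ.≤ i → ∣ i ∣ ≢ 1
2≤i⇒∣i∣≢1 (ℤ.+≤+ (s≤s ())) refl

-- A unit takes values ±1 at all integers, whereas a monic polynomial of positive degree exceeds 1
-- at large ones.
monicWith-not-unit : ∀ {ε} b → IsSign ε → ¬ Unit (monicWith ε b)
monicWith-not-unit {ε} b sign (q RawMagma., mk≈ₚ qg≡1) = 2≤i⇒∣i∣≢1 2≤gx (i*j≡1⇒∣i∣≡1 gx qx
  (trans (ℤ.*-comm gx qx) (trans (sym (eval-* q (monicWith ε b) x))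
    (trans (eval-cong (q *ₚ monicWith ε b) [ 1ℤ ] qg≡1 x) (regroup x)))))
  where
  -- The value at `n` is at least `n - ∣ ε ∣`, so 3 makes it at least 2; `n` also exceeds all
  -- coefficients in `b`.
  n = 3 ℕ.+ height b
  x = ℤ.+ n
  gx = eval (monicWith ε b) x
  qx = eval q x
  regroup : ∀ x → 1ℤ + x * 0ℤ ≡ 1ℤ
  regroup = solve-∀
  2≤gx : ℤ.+ 2 ℤ.≤ gx
  2≤gx = ℤ.≤-trans (ℤ.+≤+ (s≤s (s≤s z≤n)))
    (horner-≥ ε {1} {n} (sign-abs sign)
      (monic-eval-≥1 b (bounded-by-height b) (s≤s (ℕ.m≤n+m (height b) 2))))

candidate⇒reducible : ∀ {f ε} k t → IsSign ε →
  (∀ n → coeff f n ≡ coeff (candidate ε k t) n) → Reducible f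
candidate⇒reducible {ε = ε} k t sign f≡ =
  monicWith ε (take k t) , monicWith ε (drop k t) , mk≈ₚ f≡ ,
  monicWith-not-unit (take k t) sign , monicWith-not-unit (drop k t) sign

reducible-resp-≈ : ∀ {f g} → (∀ n → coeff f n ≡ coeff g n) → Reducible f → Reducible g
reducible-resp-≈ f≡g (p , q , mk≈ₚ f≡pq , ¬p , ¬q) =
  p , q , mk≈ₚ (λ n → trans (sym (f≡g n)) (f≡pq n)) , ¬p , ¬q

fromCoefficients : ∀ {n} → Vec ℤ n → ℤ[x]
fromCoefficients v = monicWith 1ℤ (toList v)

coeff-toList : ∀ {n} (v : Vec ℤ n) i → coeff (toList v ++ [ 1ℤ ]) (toℕ i) ≡ lookup v i
coeff-toList (c ∷ v) zero    = refl
coeff-toList (c ∷ v) (suc i) = coeff-toList v i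

coeff-toList-last : ∀ {n} (v : Vec ℤ n) → coeff (toList v ++ [ 1ℤ ]) n ≡ 1ℤ
coeff-toList-last []      = refl
coeff-toList-last (c ∷ v) = coeff-toList-last v

coeff-toList-beyond : ∀ {n} (v : Vec ℤ n) i → n < i → coeff (toList v ++ [ 1ℤ ]) i ≡ 0ℤ
coeff-toList-beyond []      (suc i) _         = refl
coeff-toList-beyond (c ∷ v) (suc i) (s≤s n<i) = coeff-toList-beyond v i n<i

coeff-toList-bounded : ∀ {n B} (v : Vec ℤ n) → 1 ≤ B → VecAll.All (λ c → ∣ c ∣ ≤ B) v →
                       ∀ i → ∣ coeff (toList v ++ [ 1ℤ ]) i ∣ ≤ B
coeff-toList-bounded []      1≤B []       zero    = 1≤B
coeff-toList-bounded []      1≤B []       (suc i) = z≤n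
coeff-toList-bounded (c ∷ v) 1≤B (b ∷ bs) zero    = b
coeff-toList-bounded (c ∷ v) 1≤B (b ∷ bs) (suc i) = coeff-toList-bounded v 1≤B bs i

coeff-tabulate : ∀ n (u : ℕ → ℤ) → u n ≡ 1ℤ → (∀ i → n < i → u i ≡ 0ℤ) →
  ∀ i → u i ≡ coeff (toList (tabulate {n = n} (u ∘ toℕ)) ++ [ 1ℤ ]) i
coeff-tabulate zero    u u≡1 u≡0 zero    = u≡1
coeff-tabulate zero    u u≡1 u≡0 (suc i) = u≡0 (suc i) (s≤s z≤n)
coeff-tabulate (suc n) u u≡1 u≡0 zero    = refl
coeff-tabulate (suc n) u u≡1 u≡0 (suc i) = coeff-tabulate n (u ∘ suc) u≡1 (λ j → u≡0 (suc j) ∘ s≤s) i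

infix 4 _≗?_
_≗?_ : ∀ p q → Dec (∀ n → coeff p n ≡ coeff q n)
[]      ≗? []      = yes λ _ → refl
[]      ≗? (b ∷ q) with 0ℤ ℤ.≟ b | [] ≗? q
... | no  ¬b | _      = no λ eq → ¬b (eq 0)
... | yes _  | no ¬q  = no λ eq → ¬q (eq ∘ suc)
... | yes b≡ | yes q≡ = yes (ℕ-cases b≡ q≡)
(a ∷ p) ≗? []      with a ℤ.≟ 0ℤ | p ≗? []
... | no  ¬a | _      = no λ eq → ¬a (eq 0)
... | yes _  | no ¬p  = no λ eq → ¬p (eq ∘ suc)
... | yes a≡ | yes p≡ = yes (ℕ-cases a≡ p≡)
(a ∷ p) ≗? (b ∷ q) with a ℤ.≟ b | p ≗? q
... | no  ¬a | _      = no λ eq → ¬a (eq 0)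
... | yes _  | no ¬p  = no λ eq → ¬p (eq ∘ suc)
... | yes a≡ | yes p≡ = yes (ℕ-cases a≡ p≡)

interval : ℕ → List ℤ
interval B = map ℤ.+_ (upTo (suc B)) ++ map ℤ.-[1+_] (upTo B)

interval-unique : ∀ B → Unique (interval B)
interval-unique B = Unique.++⁺
  (Unique.map⁺ ℤ.+-injective (Unique.upTo⁺ (suc B)))
  (Unique.map⁺ ℤ.-[1+-injective (Unique.upTo⁺ B))
  λ (x∈ , x∈′) → case ∈-map⁻ ℤ.+_ x∈ , ∈-map⁻ ℤ.-[1+_] x∈′ of λ where
    ((_ , _ , refl) , (_ , _ , ()))

length-interval : ∀ B → length (interval B) ≡ suc B ℕ.+ B
length-interval B = trans (List.length-++ (map ℤ.+_ (upTo (suc B)))) (cong₂ ℕ._+_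
  (trans (List.length-map ℤ.+_ (upTo (suc B))) (List.length-upTo (suc B)))
  (trans (List.length-map ℤ.-[1+_] (upTo B)) (List.length-upTo B)))

∈-interval⁺ : ∀ {B} c → ∣ c ∣ ≤ B → c ∈ interval B
∈-interval⁺ {B} (ℤ.+ n)      n≤B = ∈-++⁺ˡ (∈-map⁺ ℤ.+_ (∈-upTo⁺ (s≤s n≤B)))
∈-interval⁺ {B} (ℤ.-[1+ n ]) n<B = ∈-++⁺ʳ (map ℤ.+_ (upTo (suc B))) (∈-map⁺ ℤ.-[1+_] (∈-upTo⁺ n<B))

∈-interval⁻ : ∀ B {c} → c ∈ interval B → ∣ c ∣ ≤ B
∈-interval⁻ B c∈ with ∈-++⁻ (map ℤ.+_ (upTo (suc B))) c∈
... | inj₁ c∈+ = case ∈-map⁻ ℤ.+_ c∈+ of λ where (_ , n∈ , refl) → ℕ.≤-pred (∈-upTo⁻ n∈)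
... | inj₂ c∈- = case ∈-map⁻ ℤ.-[1+_] c∈- of λ where (_ , n∈ , refl) → ∈-upTo⁻ n∈

signs : List ℤ
signs = 1ℤ ∷ -1ℤ ∷ []

∈-signs⁺ : ∀ {ε} → IsSign ε → ε ∈ signs
∈-signs⁺ (inj₁ refl) = here refl
∈-signs⁺ (inj₂ refl) = there (here refl)

∈-signs⁻ : ∀ {ε} → ε ∈ signs → IsSign ε
∈-signs⁻ (here refl)         = inj₁ refl
∈-signs⁻ (there (here refl)) = inj₂ refl

shapes : ℕ → List (ℤ × ℕ)
shapes m = cartesianProduct signs (upTo (suc m))

All-toList⁻ : ∀ {p n} {P : ℤ → Set p} (v : Vec ℤ n) → All P (toList v) → VecAll.All P v
All-toList⁻ []      []       = []
All-toList⁻ (c ∷ v) (b ∷ bs) = b ∷ All-toList⁻ v bs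

module _ {m} (v : Vec ℤ (suc m)) where

  private
    f = fromCoefficients v
    d : ℕ
    d = suc (suc m)

    -- f is positive at these points, so that the values of its factors there
    -- are bounded by those of f.
    point : ℕ → ℤ
    point i = ℤ.+ (suc (height (1ℤ ∷ toList v)) ℕ.+ i)

    -- As many points as a polynomial of degree at most `d` has coefficients, as
    -- `coefficients-bounded` requires.
    points : List ℤ
    points = map point (upTo (suc d))

    points-unique : Unique points
    points-unique = Unique.map⁺
      (λ eq → ℕ.+-cancelˡ-≡ (suc (height (1ℤ ∷ toList v))) _ _ (ℤ.+-injective eq))
      (Unique.upTo⁺ (suc d))

    f≢0 : ∀ {x} → x ∈ points → eval f x ≢ 0ℤ
    f≢0 x∈ fx≡0 with ∈-map⁻ point x∈
    ... | i , _ , refl = contradiction (subst (1ℤ ℤ.≤_) fx≡0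
      (monic-eval-≥1 (1ℤ ∷ toList v) (bounded-by-height (1ℤ ∷ toList v)) (ℕ.m≤m+n _ i)))
      λ { (ℤ.+≤+ ()) }

    V C : ℕ
    V = height (map (eval f) points)
    C = interpolationBound points V

    f≤V : ∀ {x} → x ∈ points → ∣ eval f x ∣ ≤ V
    f≤V x∈ = All.lookup (bounded-by-height (map (eval f) points)) (∈-map⁺ (eval f) x∈)

    factor-bounded : ∀ g h → (∀ x → eval f x ≡ eval h x * eval g x) → length g ≤ suc d →
                     All (λ c → ∣ c ∣ ≤ C) g
    factor-bounded g h f≡hg len = coefficients-bounded g points-unique
      (All.tabulate λ {x} x∈ → ℕ.≤-trans
        (∣j∣≤∣i*j∣ (eval h x) (eval g x) λ hx≡0 → f≢0 x∈ (trans (f≡hg x) (cong (_* eval g x) hx≡0)))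
        (subst (λ y → ∣ y ∣ ≤ V) (f≡hg x) (f≤V x∈)))
      (subst (length g ≤_)
        (sym (trans (List.length-map point (upTo (suc d))) (List.length-upTo (suc d)))) len)

    length-monicWith : ∀ ε b → length b ≤ m → length (monicWith ε b) ≤ suc d
    length-monicWith ε b b≤m = s≤s (subst (_≤ d)
      (sym (trans (List.length-++ b) (ℕ.+-comm (length b) 1))) (s≤s (ℕ.m≤n⇒m≤1+n b≤m)))

    middle-bounded : ∀ ε b → All (λ c → ∣ c ∣ ≤ C) (monicWith ε b) → All (λ c → ∣ c ∣ ≤ C) b
    middle-bounded ε b (_ ∷ bs) = All.++⁻ˡ b bs

    parameters-bounded : ∀ ε k (t : Vec ℤ m) →
      (∀ n → coeff f n ≡ coeff (candidate ε k (toList t)) n) → VecAll.All (λ c → ∣ c ∣ ≤ C) t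
    parameters-bounded ε k t f≡gh = All-toList⁻ t
      (subst (All (λ c → ∣ c ∣ ≤ C)) (List.take++drop≡id k (toList t))
        (All.++⁺ (middle-bounded ε b (factor-bounded g h
                   (λ x → trans (f≡ x) (ℤ.*-comm (eval g x) (eval h x)))
                   (length-monicWith ε b (ℕ.≤-trans (ℕ.≤-reflexive (List.length-take k (toList t)))
                     (ℕ.≤-trans (ℕ.m⊓n≤n k _) t≤m)))))
                 (middle-bounded ε c (factor-bounded h g f≡
                   (length-monicWith ε c (ℕ.≤-trans (ℕ.≤-reflexive (List.length-drop k (toList t)))
                     (ℕ.≤-trans (ℕ.m∸n≤m _ k) t≤m)))))))
      where
      b = take k (toList t)
      c = drop k (toList t)
      g = monicWith ε b
      h = monicWith ε c
      t≤m = ℕ.≤-reflexive (Vec.length-toList t)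
      f≡ : ∀ x → eval f x ≡ eval g x * eval h x
      f≡ x = trans (eval-cong f (g *ₚ h) f≡gh x) (eval-* g h x)

    Matches : (ℤ × ℕ) × Vec ℤ m → Set
    Matches ((ε , k) , t) = ∀ n → coeff f n ≡ coeff (candidate ε k (toList t)) n

    matches? : Decidable Matches
    matches? ((ε , k) , t) = f ≗? candidate ε k (toList t)

    candidates : List ((ℤ × ℕ) × Vec ℤ m)
    candidates = cartesianProduct (shapes m) (vecs (interval C) m)

    ∈-candidates⁺ : ∀ {ε k t} → IsSign ε → k ≤ m → VecAll.All (λ c → ∣ c ∣ ≤ C) t →
                    ((ε , k) , t) ∈ candidates
    ∈-candidates⁺ {ε} {k} {t} sign k≤m t≤C = ∈-cartesianProduct⁺ shape∈ t∈
      where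
      shape∈ : (ε , k) ∈ shapes m
      shape∈ = ∈-cartesianProduct⁺ (∈-signs⁺ sign) (∈-upTo⁺ (s≤s k≤m))
      t∈ : t ∈ vecs (interval C) m
      t∈ = ∈-vecs⁺ (VecAll.map (λ {c} → ∈-interval⁺ c) t≤C)

    ∈-candidates⁻ : ∀ {ε k t} → ((ε , k) , t) ∈ candidates → IsSign ε
    ∈-candidates⁻ ∈candidates = ∈-signs⁻ (proj₁ (∈-cartesianProduct⁻ signs (upTo (suc m))
      (proj₁ (∈-cartesianProduct⁻ (shapes m) (vecs (interval C) m) ∈candidates))))

    match⇒reducible : ∃[ x ] x ∈ candidates × Matches x → Reducible f
    match⇒reducible (((ε , k) , t) , ∈candidates , f≡) =
      candidate⇒reducible k (toList t) (∈-candidates⁻ ∈candidates) f≡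

    reducible⇒match : Reducible f → ∃[ x ] x ∈ candidates × Matches x
    reducible⇒match red =
      let ε , k , t , sign , k≤m , f≡ = reducible⇒candidate {m} {f}
            (λ { (suc n) (s≤s l) → coeff-toList-beyond v n l }) (coeff-toList-last v) refl red
      in ((ε , k) , t) , ∈-candidates⁺ sign k≤m (parameters-bounded ε k t f≡) , f≡

  -- Opaque, since unfolding the search makes type checking very slow.
  abstract
    reducible? : Dec (Reducible f)
    reducible? = map′ (match⇒reducible ∘ find)
      (λ red → let _ , x∈ , match = reducible⇒match red in lose x∈ match)
      (Any.any? matches? candidates)

lookup-injective : ∀ {a} {A : Set a} {xs : List A} → Unique xs →
                   ∀ i j → List.lookup xs i ≡ List.lookup xs j → i ≡ j
lookup-injective (x∉ ∷ u) zero    zero    eq = refl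
lookup-injective {xs = _ ∷ _} (x∉ ∷ u) zero    (suc j) eq =
  contradiction eq (All.lookup x∉ (∈-lookup j))
lookup-injective {xs = _ ∷ _} (x∉ ∷ u) (suc i) zero    eq =
  contradiction (sym eq) (All.lookup x∉ (∈-lookup i))
lookup-injective (x∉ ∷ u) (suc i) (suc j) eq = cong suc (lookup-injective u i j eq)

-- One polynomial is represented by many lists, so `P` is not enumerated itself; `L` supplies a
-- single representative for each class of `_≈ₚ_`.
enumerates⇒cardinality : ∀ {a} {A : Set a} {P : ℤ[x] → Set} (g : A → ℤ[x]) {L : List A} → Unique L →
  (∀ {x y} → g x ≈ₚ g y → x ≡ y) → (∀ {x} → x ∈ L → P (g x)) →
  (∀ {f} → P f → ∃[ x ] x ∈ L × g x ≈ₚ f) → P HasCardinality length L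
enumerates⇒cardinality g {L} uL g-injective P-g g-onto = record
  { to        = λ i → g (List.lookup L i) , P-g (∈-lookup i)
  ; cong      = λ { refl → mk≈ₚ λ _ → refl }
  ; bijective = (λ {i} {j} eq → lookup-injective uL i j (g-injective eq)) ,
                λ (f , Pf) → case g-onto Pf of λ where
                  (x , x∈L , gx≈f) → Any.index x∈L , λ where
                    refl → subst (λ y → g y ≈ₚ f) (Any.lookup-index x∈L) gx≈f
  }

fromCoefficients-injective : ∀ {n} {v w : Vec ℤ n} → fromCoefficients v ≈ₚ fromCoefficients w → v ≡ w
fromCoefficients-injective {v = v} {w} (mk≈ₚ eq) = begin
  v                       ≡⟨ Vec.tabulate∘lookup v ⟨
  tabulate (lookup v)     ≡⟨ Vec.tabulate-cong (λ i → trans (sym (coeff-toList v i))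
                               (trans (eq (suc (toℕ i))) (coeff-toList w i))) ⟩
  tabulate (lookup w)     ≡⟨ Vec.tabulate∘lookup w ⟩
  w                       ∎
  where open ≡-Reasoning

module _ (m B : ℕ) where

  private
    d : ℕ
    d = suc (suc m)

  box : List (Vec ℤ (suc m))
  box = vecs (interval B) (suc m)

  box-unique : Unique box
  box-unique = vecs-unique (interval-unique B) (suc m)

  length-box : length box ≡ (suc B ℕ.+ B) ℕ.^ suc m
  length-box = trans (length-vecs (interval B) (suc m)) (cong (ℕ._^ suc m) (length-interval B))

  -- The coefficients fixed to 1 must respect the bound too: for `B = 0` the box has a point but no
  -- polynomial qualifies.
  box⇒P₁ : 1 ≤ B → ∀ {v} → v ∈ box → P₁ d B (fromCoefficients v)
  box⇒P₁ 1≤B {v} v∈ = record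
    { degree≤d = λ { (suc n) (s≤s l) → coeff-toList-beyond v n l }
    ; monic    = coeff-toList-last v
    ; constant = refl
    ; bounded  = λ where
        zero    → 1≤B
        (suc n) → coeff-toList-bounded v 1≤B
          (VecAll.map (∈-interval⁻ B) (∈-vecs⁻ (interval B) (suc m) v∈)) n
    }

  P₁⇒box : ∀ {f} → P₁ d B f → ∃[ v ] v ∈ box × fromCoefficients v ≈ₚ f
  P₁⇒box {f} Pf = tabulate (λ i → coeff f (suc (toℕ i))) ,
    ∈-vecs⁺ (VecAll.tabulate⁺ {f = λ i → coeff f (suc (toℕ i))}
      λ i → ∈-interval⁺ _ (P₁.bounded Pf (suc (toℕ i)))) ,
    mk≈ₚ λ where
      zero    → sym (P₁.constant Pf)
      (suc n) → sym (coeff-tabulate (suc m) (coeff f ∘ suc) (P₁.monic Pf)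
                  (λ i l → P₁.degree≤d Pf (suc i) (s≤s l)) n)

  P₁-cardinality : 1 ≤ B → P₁ d B HasCardinality length box
  P₁-cardinality 1≤B = enumerates⇒cardinality fromCoefficients box-unique
    fromCoefficients-injective (box⇒P₁ 1≤B) P₁⇒box

  R₁-cardinality : 1 ≤ B → R₁ d B HasCardinality length (filter reducible? box)
  R₁-cardinality 1≤B = enumerates⇒cardinality fromCoefficients
    (Unique.filter⁺ reducible? box-unique) fromCoefficients-injective
    (λ v∈ → case ∈-filter⁻ reducible? v∈ of λ (v∈box , red) → box⇒P₁ 1≤B v∈box , red)
    (λ (Pf , red) → case P₁⇒box Pf of λ where
      (v , v∈box , v≈f@(mk≈ₚ eq)) →
        v , ∈-filter⁺ reducible? v∈box (reducible-resp-≈ (sym ∘ eq) red) , v≈f)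

-- Transfer to ℂ and ℚ

toℚᵘ-/ : ∀ a n → ℚ.toℚᵘ (a / suc n) ℚᵘ.≃ ℚᵘ.mkℚᵘ a n
toℚᵘ-/ a n = ℚ.toℚᵘ-fromℚᵘ (ℚᵘ.mkℚᵘ a n)

/1-+ : ∀ a b → a / 1 ℚ.+ b / 1 ≡ (a + b) / 1
/1-+ a b = ℚ.toℚᵘ-injective (begin
  ℚ.toℚᵘ (a / 1 ℚ.+ b / 1)               ≈⟨ ℚ.toℚᵘ-homo-+ (a / 1) (b / 1) ⟩
  ℚ.toℚᵘ (a / 1) ℚᵘ.+ ℚ.toℚᵘ (b / 1)     ≈⟨ ℚᵘ.+-cong (toℚᵘ-/ a 0) (toℚᵘ-/ b 0) ⟩
  ℚᵘ.mkℚᵘ a 0 ℚᵘ.+ ℚᵘ.mkℚᵘ b 0           ≈⟨ ℚᵘ.*≡* (regroup a b) ⟩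
  ℚᵘ.mkℚᵘ (a + b) 0                      ≈⟨ toℚᵘ-/ (a + b) 0 ⟨
  ℚ.toℚᵘ ((a + b) / 1)                   ∎)
  where
  open ℚᵘ.≃-Reasoning
  regroup : ∀ a b → (a * 1ℤ + b * 1ℤ) * 1ℤ ≡ (a + b) * 1ℤ
  regroup = solve-∀

/1-* : ∀ a b → (a / 1) ℚ.* (b / 1) ≡ (a * b) / 1
/1-* a b = ℚ.toℚᵘ-injective (begin
  ℚ.toℚᵘ ((a / 1) ℚ.* (b / 1))               ≈⟨ ℚ.toℚᵘ-homo-* (a / 1) (b / 1) ⟩
  ℚ.toℚᵘ (a / 1) ℚᵘ.* ℚ.toℚᵘ (b / 1)     ≈⟨ ℚᵘ.*-cong (toℚᵘ-/ a 0) (toℚᵘ-/ b 0) ⟩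
  ℚᵘ.mkℚᵘ a 0 ℚᵘ.* ℚᵘ.mkℚᵘ b 0           ≈⟨ ℚᵘ.*≡* refl ⟩
  ℚᵘ.mkℚᵘ (a * b) 0                      ≈⟨ toℚᵘ-/ (a * b) 0 ⟨
  ℚ.toℚᵘ ((a * b) / 1)                   ∎)
  where open ℚᵘ.≃-Reasoning

/1≡0⇒≡0 : ∀ a → a / 1 ≡ 0ℚ → a ≡ 0ℤ
/1≡0⇒≡0 a eq with ℚᵘ.≃-trans (ℚᵘ.≃-sym (toℚᵘ-/ a 0)) (ℚᵘ.≃-reflexive (cong ℚ.toℚᵘ eq))
... | ℚᵘ.*≡* eq′ = trans (sym (ℤ.*-identityʳ a)) eq′

/≤*/ : ∀ r p c B .{{_ : NonZero p}} .{{_ : NonZero B}} → r ℕ.* B ≤ c ℕ.* p →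
       (ℤ.+ r) / p ℚ.≤ ((ℤ.+ c) / 1) ℚ.* ((ℤ.+ 1) / B)
/≤*/ r (suc p) c (suc B) rB≤cp = ℚ.toℚᵘ-cancel-≤ (begin
  ℚ.toℚᵘ ((ℤ.+ r) / suc p)
    ≃⟨ toℚᵘ-/ (ℤ.+ r) p ⟩
  ℚᵘ.mkℚᵘ (ℤ.+ r) p
    ≤⟨ ℚᵘ.*≤* numerators ⟩
  ℚᵘ.mkℚᵘ (ℤ.+ c) 0 ℚᵘ.* ℚᵘ.mkℚᵘ (ℤ.+ 1) B
    ≃⟨ ℚᵘ.*-cong (toℚᵘ-/ (ℤ.+ c) 0) (toℚᵘ-/ (ℤ.+ 1) B) ⟨
  ℚ.toℚᵘ ((ℤ.+ c) / 1) ℚᵘ.* ℚ.toℚᵘ ((ℤ.+ 1) / suc B)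
    ≃⟨ ℚ.toℚᵘ-homo-* ((ℤ.+ c) / 1) ((ℤ.+ 1) / suc B) ⟨
  ℚ.toℚᵘ (((ℤ.+ c) / 1) ℚ.* ((ℤ.+ 1) / suc B)) ∎)
  where
  open ℚᵘ.≤-Reasoning
  numerators : ℤ.+ r * ℤ.+ (1 ℕ.* suc B) ℤ.≤ ℤ.+ c * 1ℤ * ℤ.+ suc p
  numerators = subst₂ ℤ._≤_
    (trans (ℤ.pos-* r (suc B)) (cong (λ b → ℤ.+ r * ℤ.+ b) (sym (ℕ.*-identityˡ (suc B)))))
    (trans (ℤ.pos-* c (suc p)) (cong (_* ℤ.+ suc p) (sym (ℤ.*-identityʳ (ℤ.+ c)))))
    (ℤ.+≤+ rB≤cp)

-- Termwise equality instead of `_≈ᵣ_`: the operations on ℝ act termwise on sequences, so it is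
-- preserved by sums and products without any estimate.
record IsInteger (z : ℂ) (a : ℤ) : Set where
  constructor isInteger
  field
    real      : ∀ n → seq (re z) n ≡ a / 1
    imaginary : ∀ n → seq (im z) n ≡ 0ℚ

fromℤ-integer : ∀ a → IsInteger (fromℤ a) a
fromℤ-integer a = isInteger (λ _ → refl) (λ _ → refl)

+-integer : ∀ {z w a b} → IsInteger z a → IsInteger w b → IsInteger (z +ᶜ w) (a + b)
+-integer {a = a} {b} (isInteger r i) (isInteger r′ i′) = isInteger
  (λ n → trans (cong₂ ℚ._+_ (r n) (r′ n)) (/1-+ a b))
  (λ n → cong₂ ℚ._+_ (i n) (i′ n))

*-integer : ∀ {z w a b} → IsInteger z a → IsInteger w b → IsInteger (z *ᶜ w) (a * b)
*-integer {a = a} {b} (isInteger r i) (isInteger r′ i′) = isInteger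
  (λ n → trans (cong₂ (λ x y → x ℚ.+ (ℚ.- 1ℚ) ℚ.* y)
                 (cong₂ ℚ._*_ (r n) (r′ n)) (cong₂ ℚ._*_ (i n) (i′ n)))
               (trans (ℚ.+-identityʳ _) (/1-* a b)))
  (λ n → trans (cong₂ ℚ._+_ (cong₂ ℚ._*_ (r n) (i′ n)) (cong₂ ℚ._*_ (i n) (r′ n)))
               (cong₂ ℚ._+_ (ℚ.*-zeroʳ (a / 1)) (ℚ.*-zeroˡ (b / 1))))

^-integer : ∀ {z a} → IsInteger z a → ∀ j → IsInteger (z ^ᶜ j) (a ^ j)
^-integer z zero    = fromℤ-integer 1ℤ
^-integer z (suc j) = *-integer z (^-integer z j)

monomial-integer : ∀ {n} {z : Fin n → ℂ} {a : Fin n → ℤ} → (∀ i → IsInteger (z i) (a i)) →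
  ∀ e → IsInteger (product (λ i → z i ^ᶜ Vec.lookup e i)) (monomial a e)
monomial-integer z []      = fromℤ-integer 1ℤ
monomial-integer z (j ∷ e) = *-integer (^-integer (z zero) j) (monomial-integer (z ∘ suc) e)

complexify : ∀ {n} → Terms n → ℂ[ n ]
complexify = map (λ (c , e) → fromℤ c , e)

evaluate-integer : ∀ {n} {z : Fin n → ℂ} {a : Fin n → ℤ} → (∀ i → IsInteger (z i) (a i)) →
  ∀ F → IsInteger (evaluate (complexify F) z) (evalT F a)
evaluate-integer z []            = fromℤ-integer 0ℤ
evaluate-integer z ((c , e) ∷ F) =
  +-integer (*-integer (fromℤ-integer c) (monomial-integer z e)) (evaluate-integer z F)

coefficientAt-integer : ∀ {n} e (F : Terms n) →
  IsInteger (coefficientAt e (complexify F)) (coeffT e F)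
coefficientAt-integer e []             = fromℤ-integer 0ℤ
coefficientAt-integer e ((c , e′) ∷ F) with does (e′ ≟ᵉ e)
... | true  = +-integer (fromℤ-integer c) (coefficientAt-integer e F)
... | false = coefficientAt-integer e F

integer-zero : ∀ {z} → IsInteger z 0ℤ → z ≈ᶜ 0ᶜ
integer-zero {z} (isInteger r i) = near (re z) r , near (im z) i
  where
  near : ∀ x → (∀ n → seq x n ≡ 0ℚ) → x ≈ᵣ fromℚ 0ℚ
  near x x≡0 ε ε>0 = 0 , λ n _ → subst (λ y → ℚ.∣ y ℚ.- 0ℚ ∣ ℚ.< ε) (sym (x≡0 n)) ε>0

integer-nonzero : ∀ {z a} → IsInteger z a → a ≢ 0ℤ → ¬ z ≈ᶜ 0ᶜ
-- With ε equal to the absolute value of `a`, convergence to 0 fails, as every term lies at exactly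
-- that distance from 0.
integer-nonzero {z} {a} (isInteger r _) a≢0 (re≈0 , _) with re≈0 ℚ.∣ a / 1 ∣ ∣a∣>0
  where
  ∣a∣>0 : ℚ.∣ a / 1 ∣ ℚ.> 0ℚ
  ∣a∣>0 = ℚ.≰⇒> λ ∣a∣≤0 → a≢0 (/1≡0⇒≡0 a (ℚ.∣p∣≡0⇒p≡0 (a / 1) (ℚ.≤-antisym ∣a∣≤0 (ℚ.0≤∣p∣ (a / 1)))))
... | M , near = ℚ.<-irrefl (cong ℚ.∣_∣ (trans (ℚ.+-identityʳ (seq (re z) M)) (r M))) (near M ℕ.≤-refl)

-- The hypersurface

module _ {n : ℕ} where

  terms : (L : List (Vec ℕ n)) → Vec ℤ (length L) → Terms n
  terms []      []      = []
  terms (e ∷ L) (c ∷ x) = (c , e) ∷ terms L x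

  values : (Vec ℕ n → ℤ) → (L : List (Vec ℕ n)) → Vec ℤ (length L)
  values g L = Vec.map g (Vec.fromList L)

  indicator : Vec ℕ n → Vec ℕ n → ℤ
  indicator e e′ = if does (e′ ≟ᵉ e) then 1ℤ else 0ℤ

  -- For a fixed point `z`, vanishing there is one linear equation in the unknown coefficients `x`;
  -- the values of the monomials form its row.
  evalT-terms : ∀ z L x → evalT (terms L x) z ≡ values (monomial z) L · x
  evalT-terms z []      []      = refl
  evalT-terms z (e ∷ L) (c ∷ x) = cong₂ _+_ (ℤ.*-comm c (monomial z e)) (evalT-terms z L x)

  coeffT-terms : ∀ e L x → coeffT e (terms L x) ≡ values (indicator e) L · x
  coeffT-terms e []       []      = refl
  coeffT-terms e (e′ ∷ L) (c ∷ x) with does (e′ ≟ᵉ e)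
  ... | true  = cong₂ _+_ (sym (ℤ.*-identityˡ c)) (coeffT-terms e L x)
  ... | false = trans (coeffT-terms e L x) (sym (ℤ.+-identityˡ _))

  coeffT-absent : ∀ {e L} x → All (e ≢_) L → coeffT e (terms L x) ≡ 0ℤ
  coeffT-absent {L = []}             []      []          = refl
  coeffT-absent {e = e} {L = e′ ∷ L} (c ∷ x) (e≢e′ ∷ e∉L) with e′ ≟ᵉ e
  ... | yes e′≡e = contradiction (sym e′≡e) e≢e′
  ... | no  _    = coeffT-absent x e∉L

  -- Without repetitions in `L` no two terms can cancel, so a nonzero solution vector gives a
  -- nonzero polynomial.
  coeffT-lookup : ∀ {L} x → Unique L → ∀ i → coeffT (List.lookup L i) (terms L x) ≡ lookup x i
  coeffT-lookup {e ∷ L} (c ∷ x) (e∉L ∷ uL) zero with e ≟ᵉ e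
  ... | yes _  = trans (cong (c +_) (coeffT-absent x e∉L)) (ℤ.+-identityʳ c)
  ... | no e≢e = contradiction refl e≢e
  coeffT-lookup {e ∷ L} (c ∷ x) (e∉L ∷ uL) (suc i) with e ≟ᵉ List.lookup L i
  ... | yes e≡ = contradiction e≡ (All.lookup e∉L (∈-lookup i))
  ... | no  _  = coeffT-lookup x uL i

  terms-below : ∀ {N L} x → All (VecAll.All (_< N)) L → ExponentsBelow N (terms L x)
  terms-below {L = []}    []      []        = []
  terms-below {L = e ∷ L} (c ∷ x) (b ∷ bs) = b ∷ terms-below x bs

monomial-cong : ∀ {n} {z w : Fin n → ℤ} → (∀ i → z i ≡ w i) → ∀ e → monomial z e ≡ monomial w e
monomial-cong z≡w []      = refl
monomial-cong z≡w (j ∷ e) = cong₂ _*_ (cong (_^ j) (z≡w zero)) (monomial-cong (z≡w ∘ suc) e)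

evalT-cong : ∀ {n} {z w : Fin n → ℤ} → (∀ i → z i ≡ w i) → ∀ F → evalT F z ≡ evalT F w
evalT-cong z≡w []            = refl
evalT-cong z≡w ((c , e) ∷ F) = cong₂ _+_ (cong (c *_) (monomial-cong z≡w e)) (evalT-cong z≡w F)

^-distribʳ-* : ∀ a b m → (a ℕ.* b) ℕ.^ m ≡ a ℕ.^ m ℕ.* b ℕ.^ m
^-distribʳ-* a b zero    = refl
^-distribʳ-* a b (suc m) =
  trans (cong (a ℕ.* b ℕ.*_) (^-distribʳ-* a b m)) (regroup a b (a ℕ.^ m) (b ℕ.^ m))
  where
  regroup : ∀ a b x y → a ℕ.* b ℕ.* (x ℕ.* y) ≡ a ℕ.* x ℕ.* (b ℕ.* y)
  regroup = ℕ-Solver.solve-∀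

inner : ℤ[x] → ∀ {n} → Fin n → ℤ
inner f i = coeff f (suc (toℕ i))

-- With n = m + 1 coordinates and exponents below N there are N^n unknown
-- coefficients.  After substitution the degree in each of the m parameters is
-- at most 2nN, so a grid of 3nN points per parameter decides vanishing; for
-- each of the 2n shapes this gives (3nN)^m equations, and N is chosen to
-- exceed 2n(3n)^m.  One more equation makes the constant coefficient vanish.
module Elimination (m : ℕ) where

  n A N K : ℕ
  n = suc m
  A = 2 ℕ.* n ℕ.* (n ℕ.* 3) ℕ.^ m
  N = 2 ℕ.+ A
  K = n ℕ.* 3 ℕ.* N

  exponents : List (Vec ℕ n)
  exponents = vecs (upTo N) n

  grid : List ℤ
  grid = map ℤ.+_ (upTo K)

  equation : ℤ × ℕ → Vec ℤ m → Vec ℤ (length exponents)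
  equation (ε , k) t = values (monomial (inner (candidate ε k (toList t)))) exponents

  equations : List (Vec ℤ (length exponents))
  equations = values (indicator (Vec.replicate n 0)) exponents ∷
              cartesianProductWith equation (shapes m) (vecs grid m)

  length-grid : length grid ≡ K
  length-grid = trans (List.length-map ℤ.+_ (upTo K)) (List.length-upTo K)

  length-shapes : length (shapes m) ≡ 2 ℕ.* n
  length-shapes = trans (length-cartesianProductWith _,_ signs (upTo n))
                        (cong (2 ℕ.*_) (List.length-upTo n))

  fewer-equations : length equations < length exponents
  fewer-equations = begin-strict
    suc (length (cartesianProductWith equation (shapes m) (vecs grid m)))
      ≡⟨ cong suc (length-cartesianProductWith equation (shapes m) (vecs grid m)) ⟩
    suc (length (shapes m) ℕ.* length (vecs grid m))
      ≡⟨ cong suc (cong₂ ℕ._*_ length-shapes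
           (trans (length-vecs grid m) (cong (ℕ._^ m) length-grid))) ⟩
    suc (2 ℕ.* n ℕ.* (n ℕ.* 3 ℕ.* N) ℕ.^ m)
      ≡⟨ cong (λ y → suc (2 ℕ.* n ℕ.* y)) (^-distribʳ-* (n ℕ.* 3) N m) ⟩
    suc (2 ℕ.* n ℕ.* ((n ℕ.* 3) ℕ.^ m ℕ.* N ℕ.^ m))
      ≡⟨ cong suc (ℕ.*-assoc (2 ℕ.* n) ((n ℕ.* 3) ℕ.^ m) (N ℕ.^ m)) ⟨
    suc (A ℕ.* N ℕ.^ m)
      -- The summand 2 in `N` is spent here: one unit for the additional equation, one for
      -- strictness.
      <⟨ ℕ.+-monoˡ-≤ (A ℕ.* N ℕ.^ m) {2} (ℕ.*-monoʳ-≤ 2 (ℕ.m^n>0 N m)) ⟩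
    2 ℕ.* N ℕ.^ m ℕ.+ A ℕ.* N ℕ.^ m
      ≡⟨ ℕ.*-distribʳ-+ (N ℕ.^ m) 2 A ⟨
    N ℕ.^ n
      ≡⟨ trans (length-vecs (upTo N) n) (cong (ℕ._^ n) (List.length-upTo N)) ⟨
    length exponents ∎
    where open ℕ.≤-Reasoning

  private
    solution = nontrivial-solution equations fewer-equations
    x = proj₁ solution
    i = proj₁ (proj₁ (proj₂ solution))

  F : Terms n
  F = terms exponents x

  F-below : ExponentsBelow N F
  F-below = terms-below x (All.tabulate λ e∈ → VecAll.map ∈-upTo⁻ (∈-vecs⁻ (upTo N) n e∈))

  exponent : Vec ℕ n
  exponent = List.lookup exponents i

  F-nonzero : coeffT exponent F ≢ 0ℤ
  F-nonzero eq = proj₂ (proj₁ (proj₂ solution))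
    (trans (sym (coeffT-lookup x (vecs-unique (Unique.upTo⁺ N) n) i)) eq)

  F-constant : coeffT (Vec.replicate n 0) F ≡ 0ℤ
  F-constant = trans (coeffT-terms (Vec.replicate n 0) exponents x)
    (All.head (proj₂ (proj₂ solution)))

  -- The first equation makes the constant coefficient zero, so the nonzero coefficient found
  -- belongs to another monomial.
  exponent≢0 : exponent ≢ Vec.replicate n 0
  exponent≢0 eq = F-nonzero (trans (cong (λ e → coeffT e F) eq) F-constant)

  degree<grid : n ℕ.* (N ℕ.* 2) < length grid
  degree<grid = begin-strict
    n ℕ.* (N ℕ.* 2)                ≡⟨ regroup n N ⟩
    n ℕ.* N ℕ.* 2                  <⟨ ℕ.*-monoʳ-< (n ℕ.* N) {2} {3} ℕ.≤-refl ⟩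
    n ℕ.* N ℕ.* 3                  ≡⟨ regroup′ n N ⟩
    K                              ≡⟨ length-grid ⟨
    length grid                    ∎
    where
    open ℕ.≤-Reasoning
    regroup : ∀ n N → n ℕ.* (N ℕ.* 2) ≡ n ℕ.* N ℕ.* 2
    regroup = ℕ-Solver.solve-∀
    regroup′ : ∀ n N → n ℕ.* N ℕ.* 3 ≡ n ℕ.* 3 ℕ.* N
    regroup′ = ℕ-Solver.solve-∀

  -- The linear system gives vanishing at grid parameters only; the degree bound extends it to all
  -- integer parameters.
  F-vanishes-on-candidates : ∀ {ε k} → IsSign ε → k ≤ m → ∀ t →
    evalT F (inner (candidate ε k (toList t))) ≡ 0ℤ
  F-vanishes-on-candidates {ε} {k} sign k≤m = vanishes-on-grid⇒≡0 m
    (evalT-polynomial m {z = λ t → inner (candidate ε k (toList t))}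
      (λ i → candidate-polynomial m ε k (suc (toℕ i))) F F-below)
    (Unique.map⁺ ℤ.+-injective (Unique.upTo⁺ K)) degree<grid
    λ {t} t∈ → trans (evalT-terms (inner (candidate ε k (toList t))) exponents x)
      (All.lookup (All.tail (proj₂ (proj₂ solution)))
        (∈-cartesianProductWith⁺ equation
          (∈-cartesianProduct⁺ (∈-signs⁺ sign) (∈-upTo⁺ (s≤s k≤m))) t∈))

  F-vanishes : ∀ {f} → (∀ i → suc n < i → coeff f i ≡ 0ℤ) → coeff f (suc n) ≡ 1ℤ →
               coeff f 0 ≡ 1ℤ → Reducible f → evalT F (inner f) ≡ 0ℤ
  F-vanishes {f} degree monic constant red =
    let ε , k , t , sign , k≤m , f≡ = reducible⇒candidate {m} {f} degree monic constant red
    in trans (evalT-cong (λ i → f≡ (suc (toℕ i))) F) (F-vanishes-on-candidates sign k≤m t)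

module _ (m : ℕ) where

  open Elimination m

  hypersurface : AlgebraicHypersurface n
  hypersurface = record
    { equation    = complexify F
    ; nonConstant = exponent , exponent≢0 ,
                    integer-nonzero (coefficientAt-integer exponent F) F-nonzero
    }

  R₁⊆hypersurface : ∀ B f → R₁ (suc n) B f → coefficientVector (suc n) f ∈ʰ hypersurface
  R₁⊆hypersurface B f (Pf , red) = integer-zero (subst (IsInteger _)
    (F-vanishes (P₁.degree≤d Pf) (P₁.monic Pf) (P₁.constant Pf) red)
    (evaluate-integer (λ i → fromℤ-integer (inner f i)) F))

  reducible⇒zero : ∀ v → Reducible (fromCoefficients v) → evalT F (lookup v) ≡ 0ℤ
  reducible⇒zero v red = trans (evalT-cong (sym ∘ coeff-toList v) F)
    (F-vanishes {fromCoefficients v} (λ { (suc i) (s≤s l) → coeff-toList-beyond v i l })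
      (coeff-toList-last v) refl red)

  module _ (B : ℕ) where

    private
      s : ℕ
      s = length (interval B)

    reducible-count : length (filter reducible? (box m B)) ℕ.* B ≤ n ℕ.* N ℕ.* length (box m B)
    reducible-count = begin
      length (filter reducible? (box m B)) ℕ.* B
        ≤⟨ ℕ.*-mono-≤ r≤zeros B≤s ⟩
      length (filter (zero? F) (box m B)) ℕ.* s
        ≤⟨ schwartz-zippel (interval-unique B) N n F F-below exponent F-nonzero ⟩
      n ℕ.* N ℕ.* s ℕ.^ n
        ≡⟨ cong (n ℕ.* N ℕ.*_) (length-vecs (interval B) n) ⟨
      n ℕ.* N ℕ.* length (box m B) ∎
      where
      open ℕ.≤-Reasoning
      r≤zeros : length (filter reducible? (box m B)) ≤ length (filter (zero? F) (box m B))
      -- The comparison of filtered lists is applied to the identity map, which `map-id` then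
      -- removes.
      r≤zeros = subst (λ L → length (filter reducible? L) ≤ length (filter (zero? F) (box m B)))
        (List.map-id (box m B))
        (length-filter-map-≤ reducible? (zero? F) reducible⇒zero (box m B))
      B≤s : B ≤ s
      B≤s = subst (B ≤_) (sym (length-interval B)) (ℕ.m≤n+m B (suc B))

    box-nonempty : NonZero (length (box m B))
    box-nonempty = subst NonZero (sym (length-box m B)) (ℕ.m^n≢0 (suc B ℕ.+ B) n)

-- Opened only here, since it makes the sections of _+_ ambiguous.
open import Data.Integer.Base using (+_)

theorem5p1 : (d : ℕ) → 2 ≤ d →
    (Σ[ H ∈ AlgebraicHypersurface (d ∸ 1) ]
    (∀ B → 1 ≤ B → ∀ f → R₁ d B f → coefficientVector d f ∈ʰ H))
    ×
    (Σ[ C ∈ ℚ ] Σ[ B₀ ∈ ℕ ]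
    (∀ B → .{{_ : NonZero B}} → B₀ ≤ B →
    Σ[ r ∈ ℕ ] Σ[ p ∈ ℕ ] Σ[ p≢0 ∈ NonZero p ]
    R₁ d B HasCardinality r ×
    P₁ d B HasCardinality p ×
    (_/_ (+ r) p {{p≢0}}) ℚ.≤ C ℚ.* (+ 1 / B)))
theorem5p1 (suc (suc m)) (s≤s (s≤s z≤n)) =
  (hypersurface m , λ B _ → R₁⊆hypersurface m B) ,
  -- The constant is the Schwartz-Zippel factor, the number of variables times the bound on the
  -- exponents; it depends on `d` alone.
  (+ (n ℕ.* N)) / 1 , 1 , λ B 1≤B →
    length (filter reducible? (box m B)) , length (box m B) , box-nonempty m B ,
    R₁-cardinality m B 1≤B , P₁-cardinality m B 1≤B ,
    /≤*/ (length (filter reducible? (box m B))) (length (box m B)) (n ℕ.* N) B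
      {{box-nonempty m B}} (reducible-count m B)
  where open Elimination m using (n; N)
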